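{- Let $q=p^n$ with $p$ prime, and let $d$ be a divisor of $q-1$ with $2\le d<q-1$. Let $S_d=\{x^d:x\in\mathbb{F}_q^*\}$. Write the base-$p$ expansion $\frac{q-1}{d}=\sum_{j=0}^{n}e_jp^j$ with $0\le e_j\le p-1$. Suppose that at least one of the following holds: (i) $\frac{q-1}{d}\le\frac{2p}{3}$; (ii) $e_j\le\frac{p-1}{2}$ for each $0\le j<n/2$; (iii) $n=2r+1$ with $r\ge1$, $d\le 2p-2$, and $e_r\le p-1-\lceil\sqrt p\rceil/2$; (iv) $n=2r$, $d\le 2p^2$, and $e_{r-1}\le\frac{p-3}{2}$. Then there is no set $A\subset\mathbb{F}_q$ with $A+A=S_d$.
   Context: $\mathbb{F}_q$ is the finite field with $q$ elements. $A+A=\{a+a':a,a'\in A\}$. (A pair $(d,q)$ satisfying one of (i)–(iv) is called "good" in the paper.) -}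

module Defs where

open import Level using (0ℓ)
open import Algebra.Bundles using (CommutativeRing; Semiring)
import Algebra.Definitions.RawSemiring as RawSemiringDefs
open import Data.Nat.Properties using (m^n≢0)
open import Data.Nat using (ℕ; zero; suc)
import Data.Nat as N
open N using (_≤?_; _/_; _%_)
open import Data.Nat.Primality using (Prime)
open import Data.List using (List; length)
import Data.List.Membership.Setoid as SetoidMembership
import Data.List.Relation.Unary.Unique.Setoid as SetoidUnique
open import Data.Product using (Σ; ∃; _×_; _,_)
open import Data.Sum using (_⊎_)
open import Data.Bool using (Bool; true)
open import Relation.Nullary using (¬_; yes; no)
open import Relation.Binary.PropositionalEquality using (_≡_)

record IsFiniteField (R : CommutativeRing 0ℓ 0ℓ) (q : ℕ) : Set where
  open CommutativeRing R
  open SetoidMembership setoid using (_∈_)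
  field
    nontrivial : ¬ (1# ≈ 0#)
    inverse    : ∀ x → ¬ (x ≈ 0#) → ∃ λ y → (x * y) ≈ 1#
    elements   : List Carrier
    complete   : ∀ x → x ∈ elements
    distinct   : SetoidUnique.Unique setoid elements
    card       : length elements ≡ q

module _ (R : CommutativeRing 0ℓ 0ℓ) where
  open CommutativeRing R
  open RawSemiringDefs (Semiring.rawSemiring semiring) using () renaming (_^_ to _^ᶠ_)

  IsSubset : (Carrier → Bool) → Set
  IsSubset A = ∀ {x y} → x ≈ y → A x ≡ A y

  InSumset : (Carrier → Bool) → Carrier → Set
  InSumset A z = ∃ λ a → ∃ λ a' → A a ≡ true × A a' ≡ true × z ≈ (a + a')

  InS : ℕ → Carrier → Set
  InS d z = ∃ λ x → ¬ (x ≈ 0#) × z ≈ (x ^ᶠ d)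

  SumsetIsS : (Carrier → Bool) → ℕ → Set
  SumsetIsS A d = ∀ z → (InSumset A z → InS d z) × (InS d z → InSumset A z)

-- j-th digit of m in base p (only used for p ≥ 2; the value for p = 0 is a dummy)
digit : (p j m : ℕ) → ℕ
digit zero j m = 0
digit (suc k) j m = (_/_ m (suc k N.^ j) {{m^n≢0 (suc k) j}}) % suc k

ceilSqrt : ℕ → ℕ
ceilSqrt p = go (suc p) 0
  where
  go : ℕ → ℕ → ℕ
  go zero s = s
  go (suc f) s with p ≤? s N.* s
  ... | yes _ = s
  ... | no _ = go f (suc s)

-- The conditions (i)–(iv) of the theorem ("good" pairs), with m = (q-1)/d
-- and e_j = digit p j m.
Good : (p n d m : ℕ) → Set
Good p n d m =
    (3 N.* m N.≤ 2 N.* p)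
  ⊎ (∀ j → 2 N.* j N.< n → 2 N.* digit p j m N.≤ p N.∸ 1)
  ⊎ (∃ λ r → n ≡ 2 N.* r N.+ 1 × 1 N.≤ r × d N.≤ 2 N.* p N.∸ 2
             × 2 N.* digit p r m N.+ ceilSqrt p N.≤ 2 N.* (p N.∸ 1))
  ⊎ (∃ λ r → n ≡ 2 N.* r × d N.≤ 2 N.* (p N.* p)
             × 2 N.* digit p (r N.∸ 1) m N.+ 3 N.≤ p)

{-# OPTIONS --safe #-}

-- Stepanov's method in the form of Hanson and Petridis.  Let m = (q − 1)/d and let A have
-- N elements.  Choose k = j + 1 of them, a₁,…,aₖ, and weights wᵢ (a divided difference) with
-- Σ wᵢ (aᵢ + b)^e = 0 for e < j and = 1 for e = j, for every b.  If A + A ⊆ S_d, then the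
-- polynomial Σ wᵢ (X + aᵢ)^(m+j) − 1 vanishes to order k at every point of A, and its degree
-- is m as soon as p ∤ C(m+j, m); hence kN ≤ m.  On the other hand S_d ⊆ A + A forces
-- m ≤ N(N+1)/2, so (borderline cases apart) a single j with N/2 ≤ j < N and no carry in the
-- base-p addition m + j gives a contradiction, by Kummer's theorem.  In cases (ii)–(iv) a
-- first application of kN ≤ m, with j of about √q in size, bounds N from above, and this
-- makes the digit conditions strong enough to find such a j.

module Submission where

open import Defs
open import Level using (Level; 0ℓ; _⊔_)
open import Algebra.Bundles using (CommutativeRing)
import Algebra.Solver.Ring.NaturalCoefficients.Default
open import Data.Bool using (Bool; true)
import Data.Bool
open import Data.Empty using (⊥)
open import Data.List using (List; []; _∷_; _++_; length; map; filter; foldr; partition; take)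
open import Data.List.Properties using (length-++; length-map; length-take; partition-defn)
import Data.List.Membership.Setoid as MembershipSetoid
import Data.List.Membership.Setoid.Properties as MembershipProperties
import Data.List.Relation.Binary.Permutation.Setoid as PermutationSetoid
import Data.List.Relation.Binary.Permutation.Setoid.Properties as PermutationProperties
open import Data.List.Relation.Unary.All as All using (All; []; _∷_)
import Data.List.Relation.Unary.All.Properties as All
open import Data.List.Relation.Unary.AllPairs using ([]; _∷_)
open import Data.List.Relation.Unary.Any using (here; there)
import Data.List.Relation.Unary.Unique.Setoid as UniqueSetoid
import Data.List.Relation.Unary.Unique.Setoid.Properties as UniqueProperties
open import Data.Nat as ℕ using (ℕ; zero; suc; z≤n; s≤s; s≤s⁻¹)
open import Data.Nat.Combinatorics using (_C_; nCn≡1; k>n⇒nCk≡0; nCk+nC[k+1]≡[n+1]C[k+1])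
open import Data.Nat.Coprimality using (Coprime; coprime-Bézout)
import Data.Nat.Divisibility as ℕ
import Data.Nat.GCD
open Data.Nat.GCD.Bézout using (+-; -+)
open import Data.Nat.Primality using (Prime; ¬prime[0]; prime⇒irreducible)
import Data.Nat.Properties as ℕ
open import Data.Nat.Tactic.RingSolver using (solve-∀)
open import Data.Product using (∃; ∃₂; _×_; _,_; proj₁; proj₂)
open import Data.Sum using (_⊎_; inj₁; inj₂; [_,_]′)
open import Relation.Binary.Bundles using (Setoid)
open import Relation.Binary.PropositionalEquality as ≡ using (_≡_; _≢_)
open import Relation.Nullary using (¬_; Dec; yes; no; contradiction)
open import Relation.Unary using (Pred; Decidable)
open import Relation.Unary.Properties using (∁?)

-- The two estimates leave almost no slack. Together they give 2(j+1)N ≤ N(N+1), which is absurd for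
-- 2j ≥ N but merely an equality for 2j = N - 1. Such ties are settled by divisibility: dm = q - 1
-- is prime to p, so p does not divide 2m when p is odd. The tie left by condition (i) is N = m = 2,
-- where odd characteristic supplies three distinct sums a+a, a+b, b+b among the m-th roots of
-- unity.
--
-- Vanishing to order k is read off an expansion in powers of X - b, since derivatives lose
-- information in characteristic p once k > p. The coefficient of (X - b)^t in Σ wᵢ (X + aᵢ)^(m+j)
-- is C(m+j, t) times Σ wᵢ (aᵢ + b)^(m+j-t). Every (aᵢ + b)^m is 1, so for t ≤ j the exponent m
-- drops out and only the moments of order at most j remain. The same formula at b = 0 gives the
-- degree.
--
-- In (iii) and (iv) a single digit of m is controlled, so j must be a multiple c·P of the
-- corresponding power P of p. This yields N ≤ P, and then the upper bound on d finishes: in (iii)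
-- it makes m too large, in (iv) it determines the controlled digit.

module Arithmetic where

  -- Ceiling square roots, carries, and binomial coefficients modulo p

  open import Data.Nat
  open import Data.Nat.Combinatorics using (nCk≡n!/k![n-k]!; k![n∸k]!∣n!)
  open import Data.Nat.Divisibility
  open import Data.Nat.DivMod
  open import Data.Nat.Primality using (euclidsLemma; prime⇒nonTrivial; prime⇒nonZero; prime[2])
  open import Data.Nat.Properties
  open import Relation.Binary.PropositionalEquality

  -- The helper local to ceilSqrt is not in scope here; unification recovers it once its
  -- arguments have been abstracted to variables.
  mutual
    searchFrom : ℕ → ℕ → ℕ → ℕ
    searchFrom = _

    ceilSqrt≡searchFrom : ∀ x → ¬ suc x ≤ 1 → ceilSqrt (suc x) ≡ searchFrom (suc x) x 2
    ceilSqrt≡searchFrom x ≰1 with suc x ≤? 1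
    ... | yes ≤1 = contradiction ≤1 ≰1
    ... | no _ with suc x | 2
    ... | _ | _ = refl

  -- Each step trades one unit of fuel for one more in `s`, so `f + s` is invariant; the hypothesis
  -- says that the candidate left when the fuel runs out is large enough.
  searchFrom-spec : ∀ p f s → p ≤ (f + s) * (f + s) → p ≤ searchFrom p f s * searchFrom p f s
  searchFrom-spec p zero s h = h
  searchFrom-spec p (suc f) s h with p ≤? s * s
  ... | yes q = q
  ... | no _ = searchFrom-spec p f (suc s) (subst (λ x → p ≤ x * x) (sym (+-suc f s)) h)

  ceilSqrt-spec : ∀ p → p ≤ ceilSqrt p * ceilSqrt p
  ceilSqrt-spec zero          = z≤n
  ceilSqrt-spec (suc zero)    = s≤s z≤n
  -- The candidates 0 and 1 fail for an argument of at least 2, so the search is entered at 2.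
  ceilSqrt-spec (suc (suc y)) rewrite ceilSqrt≡searchFrom (suc y) (λ { (s≤s ()) }) =
    searchFrom-spec (2 + y) (1 + y) 2
      (≤-trans (m≤m+n (2 + y) 1) (≤-trans (≤-reflexive (+-comm (2 + y) 1)) (≤-trans (≤-reflexive (cong suc (+-comm 2 y))) (m≤m*n (suc y + 2) (suc y + 2)))))

  -- Lowest digits come first. The inequality puts both digits below p, so they are the genuine
  -- base-p digits; `done` stops once the second summand is exhausted and leaves the higher digits
  -- of the first one free.
  data NoCarry (p : ℕ) : ℕ → ℕ → Set where
    done : ∀ {a} → NoCarry p a 0
    step : ∀ {a₀ b₀ a b} → a₀ + b₀ < p → NoCarry p a b → NoCarry p (a₀ + a * p) (b₀ + b * p)

  C-factorial : ∀ a b → ((a + b) C a) * (a ! * b !) ≡ (a + b) !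
  C-factorial a b = begin
    ((a + b) C a) * (a ! * b !)                        ≡⟨ cong (λ x → ((a + b) C a) * (a ! * x !)) (m+n∸m≡n a b) ⟨
    ((a + b) C a) * k!*l!                              ≡⟨ cong (_* k!*l!) (nCk≡n!/k![n-k]! (m≤m+n a b)) ⟩
    (a + b) ! / k!*l! * k!*l!                          ≡⟨ m/n*n≡m (k![n∸k]!∣n! (m≤m+n a b)) ⟩
    (a + b) !                                          ∎
    where
    open ≡-Reasoning
    k!*l! = a ! * (a + b ∸ a) !
    instance _ = a !* (a + b ∸ a) !≢0

  prime⇒∤1 : ∀ {p} → Prime p → p ∤ 1
  prime⇒∤1 {p} pr p∣1 = <⇒≱ (nonTrivial⇒n>1 p {{prime⇒nonTrivial pr}}) (∣⇒≤ p∣1)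

  ∤-* : ∀ {p m n} → Prime p → p ∤ m → p ∤ n → p ∤ m * n
  ∤-* {_} {m} {n} pr p∤m p∤n p∣mn = [ p∤m , p∤n ]′ (euclidsLemma m n pr p∣mn)

  -- Among the factors of (r + ap)! the multiples of p are p, 2p, ..., ap, with product p^a · a!;
  -- the remaining factors multiply to t.
  factorial-p-part : ∀ {p} → Prime p → ∀ a r → r < p →
                     ∃ λ t → p ∤ t × (r + a * p) ! ≡ p ^ a * a ! * t
  factorial-p-part pr zero zero r<p = 1 , prime⇒∤1 pr , refl
  factorial-p-part {suc p-1} pr (suc a) zero r<p
    with t , p∤t , eq ← factorial-p-part pr a p-1 ≤-refl =
    t , p∤t , trans (cong (suc (p-1 + a * suc p-1) *_) eq) (regroup p-1 a (suc p-1 ^ a) (a !) t)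
    where
    regroup : ∀ s a x y t → suc (s + a * suc s) * (x * y * t) ≡ (suc s * x) * (suc a * y) * t
    regroup = solve-∀
  factorial-p-part {p} pr a (suc r) r<p
    with t , p∤t , eq ← factorial-p-part pr a r (<-trans (n<1+n r) r<p) =
    suc (r + a * p) * t , ∤-* pr p∤sr p∤t ,
    trans (cong (suc (r + a * p) *_) eq) (swap (suc (r + a * p)) (p ^ a * a !) t)
    where
    swap : ∀ x y t → x * (y * t) ≡ y * (x * t)
    swap = solve-∀
    p∤sr : p ∤ suc r + a * p
    p∤sr p∣ = <⇒≱ r<p (∣⇒≤ (∣m+n∣m⇒∣n (subst (p ∣_) (+-comm (suc r) (a * p)) p∣) (n∣m*n a)))

  -- One digit at a time: without a carry in the last place, the quotient of A + B by p is a + b, so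
  -- the powers of p in the three factorials cancel. Hence C(A+B, A) and C(a+b, a) agree up to
  -- factors prime to p.
  noCarry⇒∤C : ∀ {p a b} → Prime p → NoCarry p a b → p ∤ (a + b) C a
  noCarry⇒∤C {p} {a} pr done p∣ = prime⇒∤1 pr (subst (p ∣_) (*-cancelʳ-≡ _ 1 (a ! * 1) {{a !* 0 !≢0}} eq) p∣)
    where
    eq : ((a + 0) C a) * (a ! * 1) ≡ 1 * (a ! * 1)
    eq = trans (C-factorial a 0) (trans (cong _! (+-identityʳ a)) (sym (trans (*-identityˡ _) (*-identityʳ _))))
  noCarry⇒∤C {p} pr (step {a₀} {b₀} {a} {b} lt nc) p∣
    with t₁ , p∤t₁ , eq₁ ← factorial-p-part pr a a₀ (≤-<-trans (m≤m+n a₀ b₀) lt)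
       | t₂ , p∤t₂ , eq₂ ← factorial-p-part pr b b₀ (≤-<-trans (m≤n+m b₀ a₀) lt)
       | t  , p∤t  , eq  ← factorial-p-part pr (a + b) (a₀ + b₀) lt =
    ∤-* pr (noCarry⇒∤C pr nc) p∤t (subst (p ∣_) (*-cancelʳ-≡ _ _ (p ^ (a + b) * (a ! * b !)) cancelled) (∣m⇒∣m*n (t₁ * t₂) p∣))
    where
    open ≡-Reasoning
    A = a₀ + a * p
    B = b₀ + b * p
    instance
      _ = prime⇒nonZero pr
      _ = m*n≢0 (p ^ (a + b)) (a ! * b !) {{m^n≢0 p (a + b)}} {{a !* b !≢0}}
    regroup₁ : ∀ c t₁ t₂ x y u v → c * (t₁ * t₂) * (x * y * (u * v)) ≡ c * ((x * u * t₁) * (y * v * t₂))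
    regroup₁ = solve-∀
    regroup₂ : ∀ x c u v t → x * (c * (u * v)) * t ≡ c * t * (x * (u * v))
    regroup₂ = solve-∀
    regroup₃ : ∀ p a₀ b₀ a b → a₀ + a * p + (b₀ + b * p) ≡ a₀ + b₀ + (a + b) * p
    regroup₃ = solve-∀
    cancelled : ((A + B) C A) * (t₁ * t₂) * (p ^ (a + b) * (a ! * b !)) ≡ ((a + b) C a) * t * (p ^ (a + b) * (a ! * b !))
    cancelled = begin
      ((A + B) C A) * (t₁ * t₂) * (p ^ (a + b) * (a ! * b !))     ≡⟨ cong (λ x → ((A + B) C A) * (t₁ * t₂) * (x * (a ! * b !))) (^-distribˡ-+-* p a b) ⟩
      ((A + B) C A) * (t₁ * t₂) * (p ^ a * p ^ b * (a ! * b !))   ≡⟨ regroup₁ ((A + B) C A) t₁ t₂ (p ^ a) (p ^ b) (a !) (b !) ⟩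
      ((A + B) C A) * ((p ^ a * a ! * t₁) * (p ^ b * b ! * t₂))   ≡⟨ cong₂ (λ x y → ((A + B) C A) * (x * y)) eq₁ eq₂ ⟨
      ((A + B) C A) * (A ! * B !)                                 ≡⟨ C-factorial A B ⟩
      (A + B) !                                                   ≡⟨ cong _! (regroup₃ p a₀ b₀ a b) ⟩
      (a₀ + b₀ + (a + b) * p) !                                   ≡⟨ eq ⟩
      p ^ (a + b) * (a + b) ! * t                                 ≡⟨ cong (λ x → p ^ (a + b) * x * t) (C-factorial a b) ⟨
      p ^ (a + b) * (((a + b) C a) * (a ! * b !)) * t             ≡⟨ regroup₂ (p ^ (a + b)) ((a + b) C a) (a !) (b !) t ⟩
      ((a + b) C a) * t * (p ^ (a + b) * (a ! * b !))             ∎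

  double-cancel-≤ : ∀ {a b} → 2 * a ≤ suc (2 * b) → a ≤ b
  double-cancel-≤ {a} {b} 2a≤ = ≮⇒≥ λ b<a → <⇒≱ (s≤s 2a≤) (≤-trans (≤-reflexive (rearrange b)) (*-monoʳ-≤ 2 b<a))
    where
    rearrange : ∀ b → suc (suc (2 * b)) ≡ 2 * suc b
    rearrange = solve-∀

  ⌈_/2⌉-bounds : ∀ n → ∃ λ c → n ≤ 2 * c × 2 * c ≤ suc n
  ⌈ zero /2⌉-bounds = 0 , z≤n , z≤n
  ⌈ suc zero /2⌉-bounds = 1 , s≤s z≤n , ≤-refl
  ⌈ suc (suc n) /2⌉-bounds with c , n≤ , ≤n ← ⌈ n /2⌉-bounds =
    suc c , ≤-trans (s≤s (s≤s n≤)) (≤-reflexive (rearrange c)) , ≤-trans (≤-reflexive (sym (rearrange c))) (s≤s (s≤s ≤n))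
    where
    rearrange : ∀ c → suc (suc (2 * c)) ≡ 2 * suc c
    rearrange = solve-∀

  even-or-odd : ∀ n → ∃ λ h → n ≡ 2 * h ⊎ n ≡ suc (2 * h)
  even-or-odd n with c , n≤ , ≤n ← ⌈ n /2⌉-bounds | m≤n⇒m<n∨m≡n n≤
  ... | inj₂ n≡ = c , inj₁ n≡
  even-or-odd n | inj₁ n<
    with c
  ... | suc c = c , inj₂ (suc-injective (trans (≤-antisym n< ≤n) (rearrange c)))
    where
    rearrange : ∀ c → 2 * suc c ≡ suc (suc (2 * c))
    rearrange = solve-∀

  prime-∣-^ : ∀ {r a} n → Prime r → r ∣ a ^ n → r ∣ a
  prime-∣-^ zero pr r∣1 = contradiction r∣1 (prime⇒∤1 pr)
  prime-∣-^ {_} {a} (suc n) pr r∣ = [ (λ r∣a → r∣a) , prime-∣-^ n pr ]′ (euclidsLemma a (a ^ n) pr r∣)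

  prime-2∣⇒≡2 : ∀ {p} → Prime p → 2 ∣ p → p ≡ 2
  prime-2∣⇒≡2 pr 2∣p with prime⇒irreducible pr 2∣p
  ... | inj₂ 2≡p = sym 2≡p

  -- Base-p digits and summands that cause no carry

  module Digits (k : ℕ) where

    p : ℕ
    p = suc k

    digit-suc : ∀ i m → digit p (suc i) m ≡ digit p i (m / p)
    digit-suc i m = cong (_% p) (sym (m/n/o≡m/[n*o] m p (p ^ i)))
      where
      instance
        _ = m^n≢0 p i
        _ = m^n≢0 p (suc i)

    noCarry-step : ∀ {m b₀ b j} → b₀ + b * p ≡ j → m % p + b₀ < p → NoCarry p (m / p) b → NoCarry p m j
    noCarry-step {m} refl lt nc = subst (λ x → NoCarry p x _) (sym (m≡m%n+[m/n]*n m p)) (step lt nc)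

    -- The only nonzero digit of `c * p ^ s` is in place s, so one digit of m decides.
    noCarry-shifted : ∀ s m c → digit p s m + c < p → NoCarry p m (c * p ^ s)
    noCarry-shifted zero m c lt =
      noCarry-step (trans (+-identityʳ c) (sym (*-identityʳ c)))
        (subst (λ x → x % p + c < p) (n/1≡n m) lt) done
    noCarry-shifted (suc s) m c lt =
      noCarry-step (rearrange c p (p ^ s)) (subst (_< p) (sym (+-identityʳ _)) (m%n<n m p))
        (noCarry-shifted s (m / p) c (subst (λ x → x + c < p) (digit-suc s m) lt))
      where
      rearrange : ∀ c p x → 0 + c * x * p ≡ c * (p * x)
      rearrange = solve-∀

    noCarry-sum<p : ∀ m j → m + j < p → NoCarry p m j
    noCarry-sum<p m j lt = subst₂ (NoCarry p) (+-identityʳ m) (+-identityʳ j) (step {a = 0} lt done)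

  module HalfDigits (h : ℕ) where

    open Digits (2 * h) public

    -- These are the exponents j available under condition (ii): a digit of j and a digit of m, each
    -- at most h = (p - 1)/2, add up to less than p.
    data HalfDigits : ℕ → ℕ → Set where
      []  : HalfDigits 0 0
      _∷_ : ∀ {s b j} → b ≤ h → HalfDigits s j → HalfDigits (suc s) (b + j * p)

    noCarry-half : ∀ {s j} m → HalfDigits s j → (∀ i → i < s → 2 * digit p i m ≤ 2 * h) → NoCarry p m j
    noCarry-half m [] small = done
    noCarry-half m (b≤h ∷ ds) small =
      noCarry-step refl
        (s≤s (≤-trans (+-mono-≤ (*-cancelˡ-≤ 2 (subst (λ x → 2 * (x % p) ≤ 2 * h) (n/1≡n m) (small 0 z<s))) b≤h)
                      (≤-reflexive (sym (cong (h +_) (+-identityʳ h))))))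
        (noCarry-half (m / p) ds λ i i<s → subst (λ x → 2 * x ≤ 2 * h) (digit-suc i m) (small (suc i) (s≤s i<s)))

    -- With every digit equal to h this is (p^s - 1)/2, the largest member of the family.
    repunit : ∀ s → ∃ λ r → HalfDigits s r × suc (2 * r) ≡ p ^ s
    repunit zero = 0 , [] , refl
    repunit (suc s) with r , ds , eq ← repunit s =
      h + r * p , ≤-refl ∷ ds , trans (rearrange h r) (cong (p *_) eq)
      where
      rearrange : ∀ h r → suc (2 * (h + r * suc (2 * h))) ≡ suc (2 * h) * suc (2 * r)
      rearrange = solve-∀

    -- Keep the leading digits up to the first one larger than h, and put h from there on.
    round-down : ∀ s x → x < p ^ s → ∃ λ j → HalfDigits s j × j ≤ x ×
                 (x < 2 * j ⊎ (x ≡ 2 * j × (x ≡ 0 ⊎ p ∣ suc x)))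
    round-down zero x x<1 rewrite n<1⇒n≡0 x<1 = 0 , [] , z≤n , inj₂ (refl , inj₁ refl)
    round-down (suc s) x x<
      with j , ds , j≤ , near ← round-down s (x / p) (m<n*o⇒m/o<n {x} {p ^ s} {p} (subst (x <_) (*-comm p (p ^ s)) x<))
      = go (m≤n⇒m<n∨m≡n j≤)
      where
      x₀ = x % p
      x₁ = x / p
      x≡ : x ≡ x₀ + x₁ * p
      x≡ = m≡m%n+[m/n]*n x p
      x₀≤ : x₀ ≤ 2 * h
      x₀≤ = s≤s⁻¹ (m%n<n x p)
      double : ∀ y → 2 * (h + y * p) ≡ 2 * h + 2 * y * p
      double y = rearrange h y p
        where
        rearrange : ∀ h y p → 2 * (h + y * p) ≡ 2 * h + 2 * y * p
        rearrange = solve-∀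
      x<suc : ∀ {y} → suc x₁ ≤ y → x < 2 * h + y * p
      x<suc {y} lt = begin-strict
        x               ≡⟨ x≡ ⟩
        x₀ + x₁ * p     <⟨ +-monoˡ-< (x₁ * p) (s≤s x₀≤) ⟩
        suc x₁ * p      ≤⟨ *-monoˡ-≤ p lt ⟩
        y * p           ≤⟨ m≤n+m (y * p) (2 * h) ⟩
        2 * h + y * p   ∎
        where open ≤-Reasoning
      -- A tie in the higher places survives only if the last digit is 2h = p - 1, and then p
      -- divides x + 1.
      top : ∀ {y} → x₁ ≡ 2 * y → x < 2 * (h + y * p) ⊎ (x ≡ 2 * (h + y * p) × (x ≡ 0 ⊎ p ∣ suc x))
      top {y} x₁≡ with m≤n⇒m<n∨m≡n x₀≤
      ... | inj₁ x₀< = inj₁ (subst₂ _<_ (sym x≡) (sym (trans (double y) (cong (λ z → 2 * h + z * p) (sym x₁≡)))) (+-monoˡ-< (x₁ * p) x₀<))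
      ... | inj₂ x₀≡ = inj₂ ( trans x≡ (trans (cong₂ (λ u v → u + v * p) x₀≡ x₁≡) (sym (double y)))
                            , inj₂ (divides (suc x₁) (cong suc (trans x≡ (cong (_+ x₁ * p) x₀≡)))))
      go : j < x₁ ⊎ j ≡ x₁ → ∃ λ j → HalfDigits (suc s) j × j ≤ x × (x < 2 * j ⊎ (x ≡ 2 * j × (x ≡ 0 ⊎ p ∣ suc x)))
      go (inj₁ j<) = h + j * p , ≤-refl ∷ ds , below , near′ near
        where
        open ≤-Reasoning
        below : h + j * p ≤ x
        below = begin
          h + j * p    ≤⟨ +-monoˡ-≤ (j * p) (≤-trans (m≤m+n h (h + 0)) (n≤1+n _)) ⟩
          suc j * p    ≤⟨ *-monoˡ-≤ p j< ⟩
          x₁ * p       ≤⟨ m≤n+m (x₁ * p) x₀ ⟩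
          x₀ + x₁ * p  ≡⟨ x≡ ⟨
          x            ∎
        near′ : (x₁ < 2 * j ⊎ (x₁ ≡ 2 * j × (x₁ ≡ 0 ⊎ p ∣ suc x₁))) → _
        near′ (inj₁ lt)       = inj₁ (subst (x <_) (sym (double j)) (x<suc lt))
        near′ (inj₂ (eq , _)) = top {j} eq
      go (inj₂ refl) with x₀ ≤? h
      ... | yes x₀≤h = x₀ + x₁ * p , x₀≤h ∷ ds , ≤-reflexive (sym x≡) , subst (λ y → x < 2 * y ⊎ (x ≡ 2 * y × (x ≡ 0 ⊎ p ∣ suc x))) x≡ (trivial x)
        where
        trivial : ∀ x → x < 2 * x ⊎ (x ≡ 2 * x × (x ≡ 0 ⊎ p ∣ suc x))
        trivial zero    = inj₂ (refl , inj₁ refl)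
        trivial (suc y) = inj₁ (m<m+n (suc y) z<s)
      ... | no x₀≰h  = h + x₁ * p , ≤-refl ∷ ds , subst (h + x₁ * p ≤_) (sym x≡) (+-monoˡ-≤ (x₁ * p) (<⇒≤ (≰⇒> x₀≰h)))
                     , [ (λ 0<x₁ → inj₁ (subst (x <_) (sym (double x₁)) (x<suc (m<m+n x₁ (subst (0 <_) (sym (+-identityʳ x₁)) 0<x₁)))))
                       , (λ 0≡x₁ → top {x₁} (trans (sym 0≡x₁) (cong (2 *_) 0≡x₁))) ]′ (m≤n⇒m<n∨m≡n (z≤n {x₁}))

  prime∤2 : ∀ {p} → Prime p → p ≢ 2 → p ∤ 2
  prime∤2 pr p≢2 p∣2 with prime⇒irreducible prime[2] p∣2
  ... | inj₁ refl = prime⇒∤1 pr ∣-refl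
  ... | inj₂ p≡2 = p≢2 p≡2

  -- The numerical contradiction under each of the four conditions

  module _ (k : ℕ) (p-prime : Prime (suc k)) (m N : ℕ)
    (stepanov-bound : ∀ j → j < N → suc k ∤ (m + j) C m → suc j * N ≤ m)
    (2m≤N[N+1] : 2 * m ≤ N * suc N) (2≤m : 2 ≤ m) where

    open Digits k
    open ≤-Reasoning

    bound : ∀ {j} → j < N → NoCarry p m j → suc j * N ≤ m
    bound j<N nc = stepanov-bound _ j<N (noCarry⇒∤C p-prime nc)

    N≰1 : ¬ N ≤ 1
    N≰1 N≤1 = <⇒≱ (≤-trans (s≤s (s≤s (s≤s z≤n))) (*-monoʳ-≤ 2 2≤m)) (≤-trans 2m≤N[N+1] (*-mono-≤ N≤1 (s≤s N≤1)))

    -- The estimates collide: N(N+2) ≤ 2(j+1)N ≤ 2m ≤ N(N+1).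
    noCarry-absurd : ∀ {j} → j < N → N ≤ 2 * j → ¬ NoCarry p m j
    noCarry-absurd {j} j<N N≤2j nc = <-irrefl refl (begin-strict
      2 * m            ≤⟨ 2m≤N[N+1] ⟩
      N * suc N        <⟨ *-monoʳ-< N {{>-nonZero (≤-<-trans z≤n j<N)}} (n<1+n (suc N)) ⟩
      N * suc (suc N)  ≤⟨ *-monoʳ-≤ N (s≤s (s≤s N≤2j)) ⟩
      N * (2 + 2 * j)  ≡⟨ rearrange N j ⟩
      2 * (suc j * N)  ≤⟨ *-monoʳ-≤ 2 (bound j<N nc) ⟩
      2 * m            ∎)
      where
      rearrange : ∀ N j → N * (2 + 2 * j) ≡ 2 * (suc j * N)
      rearrange = solve-∀

    -- Here j = p - 1 - m is the largest exponent with m + j < p, and 3m ≤ 2p says m ≤ 2(j+1). If N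
    -- ≤ j + 1, the exponent N - 1 is allowed too and N² ≤ m contradicts 2m ≤ N(N+1). Otherwise
    -- (j+1)N ≤ m ≤ 2(j+1) leaves only N = m = 2.
    not-good-i : (p ≢ 2 → 2 ≤ N → 3 ≤ m) → ¬ 3 * m ≤ 2 * p
    not-good-i 3≤m 3m≤2p = absurd
      where
      m<p : m < p
      m<p = ≰⇒> λ p≤m → <⇒≱ (*-monoˡ-< p {2} {3} ≤-refl) (≤-trans (*-monoʳ-≤ 3 p≤m) 3m≤2p)
      j = k ∸ m
      m+j≡k : m + j ≡ k
      m+j≡k = m+[n∸m]≡n (s≤s⁻¹ m<p)
      m≤2[1+j] : m ≤ 2 * suc j
      m≤2[1+j] = +-cancelˡ-≤ (2 * m) m (2 * suc j) (begin
        2 * m + m          ≡⟨ rearrange₁ m ⟩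
        3 * m              ≤⟨ 3m≤2p ⟩
        2 * suc k          ≡⟨ cong (λ x → 2 * suc x) m+j≡k ⟨
        2 * suc (m + j)    ≡⟨ rearrange₂ m j ⟩
        2 * m + 2 * suc j  ∎)
        where
        rearrange₁ : ∀ m → 2 * m + m ≡ 3 * m
        rearrange₁ = solve-∀
        rearrange₂ : ∀ m j → 2 * suc (m + j) ≡ 2 * m + 2 * suc j
        rearrange₂ = solve-∀
      m≤2 : suc j < N → m ≤ 2
      m≤2 1+j<N = ≤-trans m≤2[1+j] (*-monoʳ-≤ 2 (s≤s⁻¹ (≤-trans 1+j<N N≤2)))
        where
        N≤2 : N ≤ 2
        N≤2 = *-cancelˡ-≤ (suc j) (begin
          suc j * N  ≤⟨ bound (<-trans (n<1+n j) 1+j<N) (noCarry-sum<p m j (s≤s (≤-reflexive m+j≡k))) ⟩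
          m          ≤⟨ m≤2[1+j] ⟩
          2 * suc j  ≡⟨ *-comm 2 (suc j) ⟩
          suc j * 2  ∎)
      p≢2 : p ≢ 2
      p≢2 p≡2 = <⇒≱ {4} (s≤s (s≤s (s≤s (s≤s (s≤s z≤n))))) (≤-trans (*-monoʳ-≤ 3 2≤m) (subst (λ x → 3 * m ≤ 2 * x) p≡2 3m≤2p))
      absurd : ⊥
      absurd with suc j <? N
      ... | yes 1+j<N = <⇒≱ (3≤m p≢2 (≰⇒> N≰1)) (m≤2 1+j<N)
      ... | no 1+j≮N = small N refl
        where
        small : ∀ n → n ≡ N → ⊥
        small zero refl = N≰1 z≤n
        small (suc x) refl = N≰1 (+-cancelˡ-≤ N N 1 (begin
          N + N  ≡⟨ cong (N +_) (+-identityʳ N) ⟨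
          2 * N  ≤⟨ *-cancelˡ-≤ N (begin
            N * (2 * N)  ≡⟨ rearrange N ⟩
            2 * (N * N)  ≤⟨ *-monoʳ-≤ 2 (bound ≤-refl (noCarry-sum<p m x (s≤s (≤-trans (+-monoʳ-≤ m (s≤s⁻¹ (≮⇒≥ 1+j≮N))) (≤-reflexive m+j≡k))))) ⟩
            2 * m        ≤⟨ 2m≤N[N+1] ⟩
            N * suc N    ∎) ⟩
          suc N  ≡⟨ +-comm 1 N ⟩
          N + 1  ∎))
          where
          rearrange : ∀ N → N * (2 * N) ≡ 2 * (N * N)
          rearrange = solve-∀

    module _ (n : ℕ) (2m<pⁿ : 2 * m < p ^ n) (p∤m : p ∤ m) where

      1≤n : 1 ≤ n
      1≤n = n≢0⇒n>0 λ n≡0 → <⇒≱ (subst (λ x → 2 * m < p ^ x) n≡0 2m<pⁿ) (≤-trans (s≤s z≤n) (*-monoʳ-≤ 2 2≤m))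

      -- The places i with 2i < n are those below s = ⌈n/2⌉. Once N < p^s is known, rounding N - 1
      -- down to a number j with half-size digits gives N ≤ 2j, apart from N = 1 and the tie N = 2j
      -- + 1 with p dividing N. The tie forces 2m = N(N+1), a multiple of p, although p is odd and
      -- does not divide m.
      not-good-ii : ¬ (∀ j → 2 * j < n → 2 * digit p j m ≤ k)
      not-good-ii small with even-or-odd k
      -- An odd k means p = 2, where the condition on the lowest digit makes m even.
      ... | h , inj₂ refl = p∤m (subst (_∣ m) (sym p≡2) (m%n≡0⇒n∣m m 2 m%2≡0))
        where
        p≡2 : p ≡ 2
        p≡2 = prime-2∣⇒≡2 p-prime (divides (suc h) (rearrange h))
          where
          rearrange : ∀ h → suc (suc (2 * h)) ≡ suc h * 2
          rearrange = solve-∀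
        k≡1 : k ≡ 1
        k≡1 = suc-injective p≡2
        m%2≡0 : m % 2 ≡ 0
        m%2≡0 = n≤0⇒n≡0 (double-cancel-≤ (subst₂ (λ x y → 2 * (x % suc y) ≤ y) (n/1≡n m) k≡1 (small 0 1≤n)))
      ... | h , inj₁ refl with s , n≤2s , 2s≤1+n ← ⌈ n /2⌉-bounds = absurd N refl
        where
        open HalfDigits h using (HalfDigits; noCarry-half; repunit; round-down)
        small′ : ∀ i → i < s → 2 * digit p i m ≤ 2 * h
        small′ i i<s = small i (s≤s⁻¹ (begin
          2 + 2 * i  ≡⟨ rearrange i ⟩
          2 * suc i  ≤⟨ *-monoʳ-≤ 2 i<s ⟩
          2 * s      ≤⟨ 2s≤1+n ⟩
          suc n      ∎))
          where
          rearrange : ∀ i → 2 + 2 * i ≡ 2 * suc i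
          rearrange = solve-∀
        half-bound : ∀ {j} → j < N → HalfDigits s j → (2 + 2 * j) * N ≤ 2 * m
        half-bound {j} j<N ds = ≤-trans (≤-reflexive (rearrange j N)) (*-monoʳ-≤ 2 (bound j<N (noCarry-half m ds small′)))
          where
          rearrange : ∀ j N → (2 + 2 * j) * N ≡ 2 * (suc j * N)
          rearrange = solve-∀
        N<pˢ : N < p ^ s
        N<pˢ with r , ds , 1+2r≡pˢ ← repunit s | r <? N
        ... | no r≮N = begin-strict
          N            ≤⟨ ≮⇒≥ r≮N ⟩
          r            ≤⟨ m≤m+n r (r + 0) ⟩
          2 * r        <⟨ n<1+n _ ⟩
          suc (2 * r)  ≡⟨ 1+2r≡pˢ ⟩
          p ^ s        ∎
        -- The preliminary bound uses j = (p^s - 1)/2: p^s · N ≤ (2j+2)N ≤ 2m < p^n ≤ p^(2s).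
        ... | yes r<N = *-cancelˡ-< (p ^ s) N (p ^ s) (begin-strict
          p ^ s * N          ≡⟨ cong (_* N) 1+2r≡pˢ ⟨
          suc (2 * r) * N    ≤⟨ *-monoˡ-≤ N (n≤1+n (suc (2 * r))) ⟩
          (2 + 2 * r) * N    ≤⟨ half-bound {r} r<N ds ⟩
          2 * m              <⟨ 2m<pⁿ ⟩
          p ^ n              ≤⟨ ^-monoʳ-≤ p n≤2s ⟩
          p ^ (s + (s + 0))  ≡⟨ cong (λ x → p ^ (s + x)) (+-identityʳ s) ⟩
          p ^ (s + s)        ≡⟨ ^-distribˡ-+-* p s s ⟩
          p ^ s * p ^ s      ∎)
        p∤2 : p ∤ 2
        p∤2 = prime∤2 p-prime λ p≡2 → prime⇒∤1 prime[2] (divides h (trans (sym (suc-injective p≡2)) (*-comm 2 h)))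
        absurd : ∀ n → n ≡ N → ⊥
        absurd zero refl = N≰1 z≤n
        absurd (suc x) refl with j , ds , j≤x , near ← round-down s x (<-trans (n<1+n x) N<pˢ) | near
        ... | inj₁ x<2j = noCarry-absurd (s≤s j≤x) x<2j (noCarry-half m ds small′)
        ... | inj₂ (_ , inj₁ refl) = N≰1 ≤-refl
        ... | inj₂ (refl , inj₂ p∣N) = [ p∤2 , p∤m ]′ (euclidsLemma 2 m p-prime (subst (p ∣_) N[N+1]≡2m (∣m⇒∣m*n (suc N) p∣N)))
          where
          N[N+1]≡2m : N * suc N ≡ 2 * m
          N[N+1]≡2m = ≤-antisym (≤-trans (≤-reflexive (*-comm N (suc N))) (half-bound {j} (s≤s j≤x) ds)) 2m≤N[N+1]

      -- With P = p^s, two exponents of the form j = cP are used. Taking c = ⌈σ/2⌉ gives N ≤ σP,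
      -- because σPN ≤ 2m < (σP)² when cP < N. If still N > P, then t = ⌊(N-1)/P⌋ satisfies 1 ≤ t <
      -- σ, and c = ⌈(t+1)/2⌉ places cP between N/2 and N - 1.
      N≤pˢ : ∀ σ s → p ^ n ≤ (σ * p ^ s) * (σ * p ^ s) → 2 * digit p s m + σ ≤ 2 * k → N ≤ p ^ s
      N≤pˢ σ s pⁿ≤ small = ≮⇒≥ (absurd N refl)
        where
        P = p ^ s
        instance _ = m^n≢0 p s
        -- Rounding τ/2 up to c costs at most one half, which parity absorbs: 2(e + c) ≤ 2(p - 1) +
        -- 1 implies e + c ≤ p - 1 for the digit e in place s.
        noCarry : ∀ τ c → τ ≤ σ → 2 * c ≤ suc τ → NoCarry p m (c * P)
        noCarry τ c τ≤σ 2c≤ = noCarry-shifted s m c (s≤s (double-cancel-≤ (begin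
          2 * (digit p s m + c)      ≡⟨ *-distribˡ-+ 2 (digit p s m) c ⟩
          2 * digit p s m + 2 * c    ≤⟨ +-monoʳ-≤ (2 * digit p s m) (≤-trans 2c≤ (s≤s τ≤σ)) ⟩
          2 * digit p s m + suc σ    ≡⟨ +-suc (2 * digit p s m) σ ⟩
          suc (2 * digit p s m + σ)  ≤⟨ s≤s small ⟩
          suc (2 * k)                ∎)))
        N≤σP : N ≤ σ * P
        N≤σP with c , σ≤2c , 2c≤ ← ⌈ σ /2⌉-bounds | c * P <? N
        ... | no cP≮N = ≤-trans (≮⇒≥ cP≮N) (*-monoˡ-≤ P c≤σ)
          where
          c≤σ : c ≤ σ
          c≤σ = double-cancel-≤ (≤-trans 2c≤ (s≤s (m≤m+n σ (σ + 0))))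
        ... | yes cP<N = <⇒≤ (*-cancelˡ-< (σ * P) N (σ * P) (begin-strict
          σ * P * N              ≤⟨ *-monoˡ-≤ N (*-monoˡ-≤ P σ≤2c) ⟩
          2 * c * P * N          ≤⟨ m≤n+m (2 * c * P * N) (2 * N) ⟩
          2 * N + 2 * c * P * N  ≡⟨ rearrange N c P ⟩
          2 * (suc (c * P) * N)  ≤⟨ *-monoʳ-≤ 2 (bound cP<N (noCarry σ c ≤-refl 2c≤)) ⟩
          2 * m                  <⟨ 2m<pⁿ ⟩
          p ^ n                  ≤⟨ pⁿ≤ ⟩
          σ * P * (σ * P)        ∎))
          where
          rearrange : ∀ N c P → 2 * N + 2 * c * P * N ≡ 2 * (suc (c * P) * N)
          rearrange = solve-∀
        absurd : ∀ n → n ≡ N → ¬ P < n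
        absurd (suc x) refl P<N with c , t<2c , 2c≤ ← ⌈ suc (x / P) /2⌉-bounds =
          noCarry-absurd (s≤s cP≤x) N≤2cP (noCarry (suc t) c (m<n*o⇒m/o<n {x} {σ} {P} N≤σP) 2c≤)
          where
          t = x / P
          1≤t : 1 ≤ t
          1≤t = m≥n⇒m/n>0 (s≤s⁻¹ P<N)
          c≤t : c ≤ t
          c≤t = double-cancel-≤ (≤-trans 2c≤ (s≤s (≤-trans (+-monoˡ-≤ t 1≤t) (≤-reflexive (cong (t +_) (sym (+-identityʳ t)))))))
          cP≤x : c * P ≤ x
          cP≤x = ≤-trans (*-monoˡ-≤ P c≤t) (m/n*n≤m x P)
          N≤2cP : suc x ≤ 2 * (c * P)
          N≤2cP = begin
            suc x                ≡⟨ cong suc (m≡m%n+[m/n]*n x P) ⟩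
            suc (x % P) + t * P  ≤⟨ +-monoˡ-≤ (t * P) (m%n<n x P) ⟩
            suc t * P            ≤⟨ *-monoˡ-≤ P t<2c ⟩
            2 * c * P            ≡⟨ *-assoc 2 c P ⟩
            2 * (c * P)          ∎

      module _ (d : ℕ) (dm≡ : suc (d * m) ≡ p ^ n) where

        1<p : 1 < p
        1<p = nonTrivial⇒n>1 p {{prime⇒nonTrivial p-prime}}

        -- With P = p^r the field has pP² elements, hence the choice σ = ⌈√p⌉ and N ≤ P. But d ≤ 2(p
        -- - 1) then gives q - 1 = dm ≤ (p - 1)P(P+1), which is smaller than pP² - 1 because P ≥ p.
        not-good-iii : ∀ r → n ≡ 2 * r + 1 → 1 ≤ r → d ≤ 2 * p ∸ 2 →
                       ¬ 2 * digit p r m + ceilSqrt p ≤ 2 * k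
        not-good-iii r n≡ 1≤r d≤ small = <⇒≱ P<N (N≤pˢ (ceilSqrt p) r pⁿ≤ small)
          where
          P = p ^ r
          instance _ = m^n≢0 p r
          pⁿ≡ : p ^ n ≡ p * (P * P)
          pⁿ≡ = trans (cong (p ^_) (trans n≡ (rearrange r))) (cong (p *_) (^-distribˡ-+-* p r r))
            where
            rearrange : ∀ r → 2 * r + 1 ≡ suc (r + r)
            rearrange = solve-∀
          pⁿ≤ : p ^ n ≤ (ceilSqrt p * P) * (ceilSqrt p * P)
          pⁿ≤ = begin
            p ^ n                                ≡⟨ pⁿ≡ ⟩
            p * (P * P)                          ≤⟨ *-monoˡ-≤ (P * P) (ceilSqrt-spec p) ⟩
            ceilSqrt p * ceilSqrt p * (P * P)    ≡⟨ rearrange (ceilSqrt p) P ⟩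
            (ceilSqrt p * P) * (ceilSqrt p * P)  ∎
            where
            rearrange : ∀ σ P → σ * σ * (P * P) ≡ (σ * P) * (σ * P)
            rearrange = solve-∀
          p≤P : p ≤ P
          p≤P = ≤-trans (≤-reflexive (sym (*-identityʳ p))) (^-monoʳ-≤ p 1≤r)
          d≤2k : d ≤ 2 * k
          d≤2k = ≤-trans d≤ (≤-reflexive (cong (_∸ 2) (rearrange k)))
            where
            rearrange : ∀ k → 2 * suc k ≡ 2 + 2 * k
            rearrange = solve-∀
          P<N : P < N
          P<N = ≰⇒> λ N≤P → <⇒≱ 1<p (≤-trans p≤P (+-cancelʳ-≤ (k * P + k * (P * P)) P 1 (begin
            P + (k * P + k * (P * P))    ≡⟨ rearrange₁ k P ⟩
            p * P + k * (P * P)          ≤⟨ +-monoˡ-≤ (k * (P * P)) (*-monoˡ-≤ P p≤P) ⟩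
            P * P + k * (P * P)          ≡⟨ pⁿ≡ ⟨
            p ^ n                        ≡⟨ dm≡ ⟨
            suc (d * m)                  ≤⟨ s≤s (*-monoˡ-≤ m d≤2k) ⟩
            suc (2 * k * m)              ≡⟨ rearrange₂ k m ⟩
            1 + k * (2 * m)              ≤⟨ +-monoʳ-≤ 1 (*-monoʳ-≤ k 2m≤N[N+1]) ⟩
            1 + k * (N * suc N)          ≤⟨ +-monoʳ-≤ 1 (*-monoʳ-≤ k (*-mono-≤ N≤P (s≤s N≤P))) ⟩
            1 + k * (P * suc P)          ≡⟨ rearrange₃ k P ⟩
            1 + (k * P + k * (P * P))    ∎)))
            where
            rearrange₁ : ∀ k P → P + (k * P + k * (P * P)) ≡ suc k * P + k * (P * P)
            rearrange₁ = solve-∀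
            rearrange₂ : ∀ k m → suc (2 * k * m) ≡ 1 + k * (2 * m)
            rearrange₂ = solve-∀
            rearrange₃ : ∀ k P → 1 + k * (P * suc P) ≡ 1 + (k * P + k * (P * P))
            rearrange₃ = solve-∀

        -- With P = p^(r-1) one has N ≤ P, while d ≤ 2p² forces P² ≤ 2m. So 2m is squeezed between
        -- P² and P(P+1), and the odd number P must equal 2⌊m/P⌋ + 1. Modulo p this reads 2e + 1 ≡ 0
        -- for the controlled digit e, whereas 0 < 2e + 1 < p. If P = 1, then N ≤ 1 is already
        -- absurd.
        not-good-iv : ∀ r → n ≡ 2 * r → d ≤ 2 * (p * p) → ¬ 2 * digit p (r ∸ 1) m + 3 ≤ p
        not-good-iv zero n≡0 = contradiction (subst (1 ≤_) n≡0 1≤n) (λ ())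
        not-good-iv (suc s) n≡ d≤ small = absurd s refl
          where
          P = p ^ s
          e = digit p s m
          instance _ = m^n≢0 p s
          pⁿ≡ : p ^ n ≡ p * p * (P * P)
          pⁿ≡ = trans (cong (p ^_) (trans n≡ (rearrange₁ s))) (trans (cong (λ x → p * (p * x)) (^-distribˡ-+-* p s s)) (rearrange₂ p P))
            where
            rearrange₁ : ∀ s → 2 * suc s ≡ suc (suc (s + s))
            rearrange₁ = solve-∀
            rearrange₂ : ∀ p P → p * (p * (P * P)) ≡ p * p * (P * P)
            rearrange₂ = solve-∀
          N≤P : N ≤ P
          -- For σ = p + 1 the inequality 2e + σ ≤ 2(p - 1) is exactly 2e + 3 ≤ p.
          N≤P = N≤pˢ (suc p) s pⁿ≤ small′
            where
            pⁿ≤ : p ^ n ≤ (suc p * P) * (suc p * P)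
            pⁿ≤ = begin
              p ^ n                      ≡⟨ pⁿ≡ ⟩
              p * p * (P * P)            ≤⟨ *-monoˡ-≤ (P * P) (*-mono-≤ (n≤1+n p) (n≤1+n p)) ⟩
              suc p * suc p * (P * P)    ≡⟨ rearrange (suc p) P ⟩
              (suc p * P) * (suc p * P)  ∎
              where
              rearrange : ∀ σ P → σ * σ * (P * P) ≡ (σ * P) * (σ * P)
              rearrange = solve-∀
            small′ : 2 * e + suc p ≤ 2 * k
            small′ = begin
              2 * e + suc (suc k)  ≡⟨ rearrange e k ⟩
              (2 * e + 2) + k      ≤⟨ +-monoˡ-≤ k (s≤s⁻¹ (≤-trans (≤-reflexive (sym (+-suc (2 * e) 2))) small)) ⟩
              k + k                ≡⟨ cong (k +_) (+-identityʳ k) ⟨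
              2 * k                ∎
              where
              rearrange : ∀ e k → 2 * e + suc (suc k) ≡ (2 * e + 2) + k
              rearrange = solve-∀
          p²P²≤ : p * p * (P * P) ≤ suc (p * p * (2 * m))
          p²P²≤ = begin
            p * p * (P * P)        ≡⟨ trans dm≡ pⁿ≡ ⟨
            suc (d * m)            ≤⟨ s≤s (*-monoˡ-≤ m d≤) ⟩
            suc (2 * (p * p) * m)  ≡⟨ cong suc (rearrange p m) ⟩
            suc (p * p * (2 * m))  ∎
            where
            rearrange : ∀ p m → 2 * (p * p) * m ≡ p * p * (2 * m)
            rearrange = solve-∀
          1<p² : 1 < p * p
          1<p² = *-mono-≤ {1} (≤-trans (n≤1+n 1) 1<p) 1<p
          P²≤2m : P * P ≤ 2 * m
          P²≤2m = ≮⇒≥ λ 2m<P² → <⇒≱ 1<p² (+-cancelˡ-≤ (p * p * (2 * m)) (p * p) 1 (begin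
            p * p * (2 * m) + p * p  ≡⟨ rearrange (p * p) (2 * m) ⟩
            p * p * suc (2 * m)      ≤⟨ *-monoʳ-≤ (p * p) 2m<P² ⟩
            p * p * (P * P)          ≤⟨ p²P²≤ ⟩
            suc (p * p * (2 * m))    ≡⟨ +-comm 1 (p * p * (2 * m)) ⟩
            p * p * (2 * m) + 1      ∎))
            where
            rearrange : ∀ y x → y * x + y ≡ y * suc x
            rearrange = solve-∀
          3≤p : 3 ≤ p
          3≤p = ≤-trans (m≤n+m 3 (2 * e)) small
          p≢2 : p ≢ 2
          p≢2 p≡2 = <⇒≱ 3≤p (≤-reflexive p≡2)
          absurd : ∀ t → t ≡ s → ⊥
          absurd zero refl = N≰1 N≤P
          absurd (suc t) refl = [ P-odd , P-even ]′ (m≤n⇒m<n∨m≡n 2w≤P)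
            where
            w = m / P
            v = w / p
            w≡ : w ≡ e + v * p
            w≡ = m≡m%n+[m/n]*n w p
            p∣P : p ∣ P
            p∣P = m∣m*n (p ^ t)
            -- Equality would make p, a divisor of P since s > 0, divide 2m.
            2m<P[P+1] : 2 * m < suc P * P
            2m<P[P+1] = subst (2 * m <_) (*-comm P (suc P)) (≤∧≢⇒< (≤-trans 2m≤N[N+1] (*-mono-≤ N≤P (s≤s N≤P)))
              λ 2m≡ → [ prime∤2 p-prime p≢2 , p∤m ]′ (euclidsLemma 2 m p-prime (subst (p ∣_) (sym 2m≡) (∣m⇒∣m*n (suc P) p∣P))))
            2w≤P : 2 * w ≤ P
            2w≤P = s≤s⁻¹ (*-cancelʳ-< P (2 * w) (suc P) (begin-strict
              2 * w * P    ≡⟨ *-assoc 2 w P ⟩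
              2 * (w * P)  ≤⟨ *-monoʳ-≤ 2 (m/n*n≤m m P) ⟩
              2 * m        <⟨ 2m<P[P+1] ⟩
              suc P * P    ∎))
            P<2[w+1] : P < 2 * suc w
            P<2[w+1] = *-cancelʳ-< P P (2 * suc w) (begin-strict
              P * P                    ≤⟨ P²≤2m ⟩
              2 * m                    ≡⟨ cong (2 *_) (m≡m%n+[m/n]*n m P) ⟩
              2 * (m % P + w * P)      <⟨ *-monoʳ-< 2 (+-monoˡ-< (w * P) (m%n<n m P)) ⟩
              2 * (suc w * P)          ≡⟨ *-assoc 2 (suc w) P ⟨
              2 * suc w * P            ∎)
            P-even : 2 * w ≡ P → ⊥
            P-even 2w≡P = p≢2 (prime-2∣⇒≡2 p-prime (prime-∣-^ s prime[2] (subst (2 ∣_) 2w≡P (m∣m*n w))))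
            P-odd : 2 * w < P → ⊥
            P-odd 2w<P = <⇒≱ (≤-trans (≤-reflexive (+-comm 1 (suc (2 * e)))) (≤-trans (≤-trans (≤-reflexive (rearrange₀ e)) (+-monoʳ-≤ (2 * e) (n≤1+n 2))) small)) (∣⇒≤ p∣1+2e)
              where
              rearrange₀ : ∀ e → suc (2 * e) + 1 ≡ 2 * e + 2
              rearrange₀ = solve-∀
              rearrange₁ : ∀ w → 2 * suc w ≡ suc (suc (2 * w))
              rearrange₁ = solve-∀
              rearrange₂ : ∀ e v p → suc (2 * (e + v * p)) ≡ 2 * v * p + suc (2 * e)
              rearrange₂ = solve-∀
              1+2w≡P : suc (2 * w) ≡ P
              1+2w≡P = ≤-antisym 2w<P (s≤s⁻¹ (subst (P <_) (rearrange₁ w) P<2[w+1]))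
              p∣1+2e : p ∣ suc (2 * e)
              p∣1+2e = ∣m+n∣m⇒∣n (subst (p ∣_) (trans (sym 1+2w≡P) (trans (cong (λ x → suc (2 * x)) w≡) (rearrange₂ e v p))) p∣P) (n∣m*n (2 * v))

    not-good : ∀ n d → p ∤ m → 2 ≤ d → suc (d * m) ≡ p ^ n →
               (p ≢ 2 → 2 ≤ N → 3 ≤ m) → ¬ Good p n d m
    not-good n d p∤m 2≤d dm≡ 3≤m = λ where
        (inj₁ i)                                        → not-good-i 3≤m i
        (inj₂ (inj₁ ii))                                → not-good-ii n 2m<pⁿ p∤m ii
        (inj₂ (inj₂ (inj₁ (r , n≡ , 1≤r , d≤ , small)))) → not-good-iii n 2m<pⁿ p∤m d dm≡ r n≡ 1≤r d≤ small
        (inj₂ (inj₂ (inj₂ (r , n≡ , d≤ , small))))       → not-good-iv n 2m<pⁿ p∤m d dm≡ r n≡ d≤ small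
      where
      2m<pⁿ : 2 * m < p ^ n
      2m<pⁿ = subst (2 * m <_) dm≡ (s≤s (*-monoˡ-≤ m 2≤d))

-- Polynomials as coefficient sequences that are eventually zero

module Polynomials {c ℓ : Level} (R : CommutativeRing c ℓ) where

  open CommutativeRing R

  open import Algebra.Solver.Ring.NaturalCoefficients.Default commutativeSemiring
  open import Relation.Binary.Reasoning.Setoid setoid

  Seq : Set c
  Seq = ℕ → Carrier

  -- The Cauchy product, by recursion on the index: writing f = f₀ + X f⁺, the coefficient of fg in
  -- degree n + 1 is f₀ gₙ₊₁ plus that of f⁺g in degree n.
  conv : Seq → Seq → Seq
  conv f g zero    = f 0 * g 0
  conv f g (suc n) = f 0 * g (suc n) + conv (λ i → f (suc i)) g n

  conv-cong : ∀ {f f′ g g′} → (∀ n → f n ≈ f′ n) → (∀ n → g n ≈ g′ n) → ∀ n → conv f g n ≈ conv f′ g′ n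
  conv-cong f≈ g≈ zero    = *-cong (f≈ 0) (g≈ 0)
  conv-cong f≈ g≈ (suc n) = +-cong (*-cong (f≈ 0) (g≈ (suc n))) (conv-cong (λ i → f≈ (suc i)) g≈ n)

  conv-distribʳ : ∀ h f g n → conv (λ i → f i + g i) h n ≈ conv f h n + conv g h n
  conv-distribʳ h f g zero    = distribʳ _ _ _
  conv-distribʳ h f g (suc n) = trans (+-cong (distribʳ _ _ _) (conv-distribʳ h (λ i → f (suc i)) (λ i → g (suc i)) n)) (rearrange _ _ _ _)
    where
    rearrange : ∀ a b c d → (a + b) + (c + d) ≈ (a + c) + (b + d)
    rearrange = solve 4 (λ a b c d → (a :+ b) :+ (c :+ d) := (a :+ c) :+ (b :+ d)) refl

  conv-scaleˡ : ∀ a f g n → conv (λ i → a * f i) g n ≈ a * conv f g n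
  conv-scaleˡ a f g zero    = *-assoc _ _ _
  conv-scaleˡ a f g (suc n) = trans (+-cong (*-assoc _ _ _) (conv-scaleˡ a (λ i → f (suc i)) g n)) (sym (distribˡ _ _ _))

  conv-zeroˡ : ∀ {f} g → (∀ n → f n ≈ 0#) → ∀ n → conv f g n ≈ 0#
  conv-zeroˡ g f≈0 zero    = trans (*-congʳ (f≈0 0)) (zeroˡ _)
  conv-zeroˡ g f≈0 (suc n) = trans (+-cong (trans (*-congʳ (f≈0 0)) (zeroˡ _)) (conv-zeroˡ g (λ i → f≈0 (suc i)) n)) (+-identityˡ 0#)

  -- This peels off the constant term of the second factor instead of the first; commutativity then
  -- follows by induction.
  conv-last : ∀ f g n → conv f g (suc n) ≈ g 0 * f (suc n) + conv f (λ i → g (suc i)) n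
  conv-last f g zero    = rearrange _ _ _ _
    where
    rearrange : ∀ a b c d → a * b + c * d ≈ d * c + a * b
    rearrange = solve 4 (λ a b c d → a :* b :+ c :* d := d :* c :+ a :* b) refl
  conv-last f g (suc n) = trans (+-congˡ (conv-last (λ i → f (suc i)) g n)) (rearrange _ _ _)
    where
    rearrange : ∀ a b c → a + (b + c) ≈ b + (a + c)
    rearrange = solve 3 (λ a b c → a :+ (b :+ c) := b :+ (a :+ c)) refl

  conv-comm : ∀ f g n → conv f g n ≈ conv g f n
  conv-comm f g zero    = *-comm _ _
  conv-comm f g (suc n) = trans (+-congˡ (conv-comm (λ i → f (suc i)) g n)) (sym (conv-last g f n))

  conv-assoc : ∀ f g h n → conv (conv f g) h n ≈ conv f (conv g h) n
  conv-assoc f g h zero    = *-assoc _ _ _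
  conv-assoc f g h (suc n) = begin
    f 0 * g 0 * h (suc n) + conv (λ i → f 0 * g (suc i) + conv f⁺ g i) h n                ≈⟨ +-congˡ (conv-distribʳ h (λ i → f 0 * g (suc i)) (conv f⁺ g) n) ⟩
    f 0 * g 0 * h (suc n) + (conv (λ i → f 0 * g (suc i)) h n + conv (conv f⁺ g) h n)     ≈⟨ +-congˡ (+-cong (conv-scaleˡ (f 0) g⁺ h n) (conv-assoc f⁺ g h n)) ⟩
    f 0 * g 0 * h (suc n) + (f 0 * conv g⁺ h n + conv f⁺ (conv g h) n)                    ≈⟨ rearrange _ _ _ _ _ ⟩
    f 0 * (g 0 * h (suc n) + conv g⁺ h n) + conv f⁺ (conv g h) n                          ∎
    where
    f⁺ g⁺ : Seq
    f⁺ i = f (suc i)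
    g⁺ i = g (suc i)
    rearrange : ∀ a b c d e → a * b * c + (a * d + e) ≈ a * (b * c + d) + e
    rearrange = solve 5 (λ a b c d e → a :* b :* c :+ (a :* d :+ e) := a :* (b :* c :+ d) :+ e) refl

  Vanishes : ℕ → Seq → Set ℓ
  Vanishes l f = ∀ n → l ℕ.≤ n → f n ≈ 0#

  conv-vanishes : ∀ {k l f g} → Vanishes k f → Vanishes l g → Vanishes (k ℕ.+ l) (conv f g)
  conv-vanishes {zero}          f0 g0 n       _  = conv-zeroˡ _ (λ i → f0 i z≤n) n
  conv-vanishes {suc k}         f0 g0 (suc n) le =
    trans (+-cong (trans (*-congˡ (g0 (suc n) (ℕ.≤-trans (ℕ.m≤n+m _ (suc k)) le))) (zeroʳ _))
                  (conv-vanishes (λ i k≤i → f0 (suc i) (s≤s k≤i)) g0 n (s≤s⁻¹ le)))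
          (+-identityˡ 0#)

  -- `bound` is any index from which the coefficients vanish, not the degree, so no leading
  -- coefficient ever has to be tested for zero. It is where the downward induction of
  -- `quotient-vanishes` starts.
  record Poly : Set (c ⊔ ℓ) where
    constructor poly
    field
      coeff    : Seq
      bound    : ℕ
      vanishes : Vanishes bound coeff

  open Poly public

  -- A record rather than a function type, so that f and g can be inferred from f ≋ g.
  record _≋_ (f g : Poly) : Set ℓ where
    constructor coeffwise
    field
      _at_ : ∀ n → coeff f n ≈ coeff g n

  open _≋_ public

  const-seq : Carrier → Seq
  const-seq a zero    = a
  const-seq a (suc n) = 0#

  const : Carrier → Poly
  const a = poly (const-seq a) 1 λ { (suc n) _ → refl }

  _⊕_ _⊗_ : Poly → Poly → Poly
  f ⊕ g = poly (λ n → coeff f n + coeff g n) (bound f ℕ.+ bound g) λ n le →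
    trans (+-cong (vanishes f n (ℕ.≤-trans (ℕ.m≤m+n _ _) le)) (vanishes g n (ℕ.≤-trans (ℕ.m≤n+m _ (bound f)) le))) (+-identityˡ 0#)
  f ⊗ g = poly (conv (coeff f) (coeff g)) (bound f ℕ.+ bound g) (conv-vanishes (vanishes f) (vanishes g))

  ⊖_ : Poly → Poly
  ⊖ f = poly (λ n → - coeff f n) (bound f) λ n le → trans (-‿cong (vanishes f n le)) -0#≈0#
    where open import Algebra.Properties.Ring ring using (-0#≈0#)

  conv-const : ∀ a f n → conv (const-seq a) f n ≈ a * f n
  conv-const a f zero    = refl
  conv-const a f (suc n) = trans (+-congˡ (conv-zeroˡ f (λ _ → refl) n)) (+-identityʳ _)

  polyRing : CommutativeRing (c ⊔ ℓ) ℓ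
  polyRing = record
    { Carrier = Poly ; _≈_ = _≋_ ; _+_ = _⊕_ ; _*_ = _⊗_ ; -_ = ⊖_ ; 0# = poly (λ _ → 0#) 0 (λ _ _ → refl) ; 1# = const 1#
    ; isCommutativeRing = record
      { isRing = record
        { +-isAbelianGroup = record
          { isGroup = record
            { isMonoid = record
              { isSemigroup = record
                { isMagma = record
                  { isEquivalence = record
                    { refl  = coeffwise λ _ → refl
                    ; sym   = λ p → coeffwise λ n → sym (p at n)
                    ; trans = λ p q → coeffwise λ n → trans (p at n) (q at n) }
                  ; ∙-cong = λ p q → coeffwise λ n → +-cong (p at n) (q at n) }
                ; assoc = λ _ _ _ → coeffwise λ _ → +-assoc _ _ _ }
              ; identity = (λ _ → coeffwise λ _ → +-identityˡ _) , (λ _ → coeffwise λ _ → +-identityʳ _) }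
            ; inverse = (λ _ → coeffwise λ _ → -‿inverseˡ _) , (λ _ → coeffwise λ _ → -‿inverseʳ _)
            ; ⁻¹-cong = λ p → coeffwise λ n → -‿cong (p at n) }
          ; comm = λ _ _ → coeffwise λ _ → +-comm _ _ }
        ; *-cong = λ p q → coeffwise (conv-cong (p at_) (q at_))
        ; *-assoc = λ f g h → coeffwise (conv-assoc (coeff f) (coeff g) (coeff h))
        ; *-identity = (λ f → coeffwise (one f)) , (λ f → coeffwise λ n → trans (conv-comm (coeff f) (const-seq 1#) n) (one f n))
        ; distrib = (λ h f g → coeffwise λ n → trans (conv-comm (coeff h) (coeff (f ⊕ g)) n)
                                (trans (conv-distribʳ (coeff h) (coeff f) (coeff g) n)
                                       (+-cong (conv-comm (coeff f) (coeff h) n) (conv-comm (coeff g) (coeff h) n))))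
                  , (λ h f g → coeffwise (conv-distribʳ (coeff h) (coeff f) (coeff g))) }
      ; *-comm = λ f g → coeffwise (conv-comm (coeff f) (coeff g)) } }
    where
    one : ∀ f n → conv (const-seq 1#) (coeff f) n ≈ coeff f n
    one f n = trans (conv-const 1# (coeff f) n) (*-identityˡ _)

-- Bézout identities and products of coprime divisors

module Comaximality {c ℓ : Level} (R : CommutativeRing c ℓ) where

  open CommutativeRing R
  open import Algebra.Solver.Ring.NaturalCoefficients.Default commutativeSemiring
  open import Algebra.Properties.Semiring.Exp semiring using (_^_)
  open import Algebra.Properties.Semiring.Divisibility semiring using (_∣_; _,_)
  open import Relation.Binary.Reasoning.Setoid setoid

  -- An explicit Bézout identity takes the place of gcds and unique factorisation: it suffices to
  -- combine the divisors (X - b)^k for different b.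
  Comaximal : Carrier → Carrier → Set (c ⊔ ℓ)
  Comaximal x y = ∃₂ λ u v → u * x + v * y ≈ 1#

  comaximal-sym : ∀ {x y} → Comaximal x y → Comaximal y x
  comaximal-sym (u , v , eq) = v , u , trans (+-comm _ _) eq

  comaximal-1 : ∀ y → Comaximal 1# y
  comaximal-1 y = 1# , 0# , trans (+-cong (*-identityˡ 1#) (zeroˡ y)) (+-identityʳ 1#)

  comaximal-* : ∀ {x y z} → Comaximal x z → Comaximal y z → Comaximal (x * y) z
  comaximal-* {x} {y} {z} (u , v , eq) (u′ , v′ , eq′) =
    u * u′ , u * x * v′ + v * u′ * y + v * v′ * z , (begin
      u * u′ * (x * y) + (u * x * v′ + v * u′ * y + v * v′ * z) * z  ≈⟨ rearrange u v u′ v′ x y z ⟩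
      (u * x + v * z) * (u′ * y + v′ * z)                            ≈⟨ *-cong eq eq′ ⟩
      1# * 1#                                                        ≈⟨ *-identityˡ 1# ⟩
      1#                                                             ∎)
    where
    rearrange : ∀ u v s t x y z → u * s * (x * y) + (u * x * t + v * s * y + v * t * z) * z ≈ (u * x + v * z) * (s * y + t * z)
    rearrange = solve 7 (λ u v s t x y z → u :* s :* (x :* y) :+ (u :* x :* t :+ v :* s :* y :+ v :* t :* z) :* z := (u :* x :+ v :* z) :* (s :* y :+ t :* z)) refl

  comaximal-^ : ∀ {x y} n → Comaximal x y → Comaximal (x ^ n) y
  comaximal-^ zero    _  = comaximal-1 _
  comaximal-^ (suc n) cm = comaximal-* cm (comaximal-^ n cm)

  comaximal-∣-* : ∀ {x y f} → Comaximal x y → x ∣ f → y ∣ f → x * y ∣ f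
  comaximal-∣-* {x} {y} {f} (u , v , eq) (g , gx≈f) (h , hy≈f) = u * h + v * g , (begin
    (u * h + v * g) * (x * y)              ≈⟨ rearrange u v g h x y ⟩
    u * x * (h * y) + v * y * (g * x)      ≈⟨ +-cong (*-congˡ hy≈f) (*-congˡ gx≈f) ⟩
    u * x * f + v * y * f                  ≈⟨ distribʳ f (u * x) (v * y) ⟨
    (u * x + v * y) * f                    ≈⟨ *-congʳ eq ⟩
    1# * f                                 ≈⟨ *-identityˡ f ⟩
    f                                      ∎)
    where
    rearrange : ∀ u v g h x y → (u * h + v * g) * (x * y) ≈ u * x * (h * y) + v * y * (g * x)
    rearrange = solve 6 (λ u v g h x y → (u :* h :+ v :* g) :* (x :* y) := u :* x :* (h :* y) :+ v :* y :* (g :* x)) refl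

-- Counting roots with multiplicity, and expansions around a point

module PolynomialProperties {c ℓ : Level} (R : CommutativeRing c ℓ) where

  open CommutativeRing R
  open Polynomials R
  module P = CommutativeRing polyRing
  open import Algebra.Properties.Semiring.Exp P.semiring using (_^_)
  open import Algebra.Properties.Semiring.Divisibility P.semiring using (_∣_; _,_)
  module CS = Algebra.Solver.Ring.NaturalCoefficients.Default commutativeSemiring
  module PS = Algebra.Solver.Ring.NaturalCoefficients.Default P.commutativeSemiring

  const-cong : ∀ {a b} → a ≈ b → const a P.≈ const b
  const-cong a≈b = coeffwise λ { zero → a≈b ; (suc n) → refl }

  const-+ : ∀ a b → const (a + b) P.≈ const a P.+ const b
  const-+ a b = coeffwise λ { zero → refl ; (suc n) → sym (+-identityˡ 0#) }

  const-0 : const 0# P.≈ P.0#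
  const-0 = coeffwise λ { zero → refl ; (suc n) → refl }

  const-* : ∀ a b → const (a * b) P.≈ const a P.* const b
  const-* a b = coeffwise λ { zero → refl ; (suc n) → sym (trans (conv-const a (const-seq b) (suc n)) (zeroʳ a)) }

  X : Poly
  X = poly seq 2 λ { (suc zero) (s≤s ()) ; (suc (suc n)) _ → refl }
    where
    seq : Seq
    seq zero    = 0#
    seq (suc n) = const-seq 1# n

  X*-zero : ∀ f → coeff (X P.* f) 0 ≈ 0#
  X*-zero f = zeroˡ _

  X*-suc : ∀ f n → coeff (X P.* f) (suc n) ≈ coeff f n
  X*-suc f n = trans (+-cong (zeroˡ _) (trans (conv-const 1# (coeff f) n) (*-identityˡ _))) (+-identityˡ _)

  X-_ : Carrier → Poly
  X- b = X P.+ const (- b)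

  X-*-suc : ∀ b f n → coeff ((X- b) P.* f) (suc n) ≈ coeff f n + - b * coeff f (suc n)
  X-*-suc b f n = trans (P.distribʳ f X (const (- b)) at suc n) (+-cong (X*-suc f n) (conv-const (- b) (coeff f) (suc n)))

  -- With g = (X - b) f one has fₙ = gₙ₊₁ + b fₙ₊₁, so zeros propagate downwards from the bound of f
  -- as long as the coefficients of g vanish.
  quotient-vanishes : ∀ {l} b f → Vanishes l (coeff ((X- b) P.* f)) → Vanishes (l ℕ.∸ 1) (coeff f)
  quotient-vanishes {l} b f g0 n le = go (bound f) n (ℕ.m≤m+n (bound f) n) (ℕ.≤-trans (ℕ.m≤n+m∸n l 1) (s≤s le))
    where
    go : ∀ e n → bound f ℕ.≤ e ℕ.+ n → l ℕ.≤ suc n → coeff f n ≈ 0#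
    go zero    n le _ = vanishes f n le
    go (suc e) n le l≤ = begin
      coeff f n                              ≈⟨ +-identityʳ _ ⟨
      coeff f n + 0#                         ≈⟨ +-congˡ (zeroʳ (- b)) ⟨
      coeff f n + - b * 0#                   ≈⟨ +-congˡ (*-congˡ (go e (suc n) (≡.subst (bound f ℕ.≤_) (≡.sym (ℕ.+-suc e n)) le) (ℕ.m≤n⇒m≤1+n l≤))) ⟨
      coeff f n + - b * coeff f (suc n)      ≈⟨ X-*-suc b f n ⟨
      coeff ((X- b) P.* f) (suc n)           ≈⟨ g0 (suc n) l≤ ⟩
      0#                                     ∎
      where open import Relation.Binary.Reasoning.Setoid setoid

  vanishes-resp : ∀ {l f g} → f P.≈ g → Vanishes l (coeff f) → Vanishes l (coeff g)
  vanishes-resp f≈g f0 n le = trans (sym (f≈g at n)) (f0 n le)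

  quotient-vanishes-^ : ∀ k {l} b f → Vanishes l (coeff ((X- b) ^ k P.* f)) → Vanishes (l ℕ.∸ k) (coeff f)
  quotient-vanishes-^ zero        b f g0 = vanishes-resp (P.*-identityˡ f) g0
  quotient-vanishes-^ (suc k) {l} b f g0 =
    ≡.subst (λ x → Vanishes x (coeff f)) (ℕ.∸-+-assoc l 1 k)
      (quotient-vanishes-^ k b f (quotient-vanishes b ((X- b) ^ k P.* f)
        (vanishes-resp (P.*-assoc (X- b) ((X- b) ^ k) f) g0)))

  rootProduct : ℕ → List Carrier → Poly
  rootProduct k []       = P.1#
  rootProduct k (b ∷ bs) = (X- b) ^ k P.* rootProduct k bs

  cofactor-vanishes : ∀ k bs {l} f → Vanishes l (coeff (rootProduct k bs P.* f)) → Vanishes (l ℕ.∸ length bs ℕ.* k) (coeff f)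
  cofactor-vanishes k []           f g0 = vanishes-resp (P.*-identityˡ f) g0
  cofactor-vanishes k (b ∷ bs) {l} f g0 =
    ≡.subst (λ x → Vanishes x (coeff f)) (ℕ.∸-+-assoc l k (length bs ℕ.* k))
      (cofactor-vanishes k bs f (quotient-vanishes-^ k b (rootProduct k bs P.* f)
        (vanishes-resp (P.*-assoc ((X- b) ^ k) (rootProduct k bs) f) g0)))

  -- A nonzero polynomial of degree < l has fewer than l roots, counted with multiplicity.
  rootProduct∣⇒≈0 : ∀ k bs {l f} → rootProduct k bs ∣ f → Vanishes l (coeff f) → l ℕ.≤ length bs ℕ.* k → f P.≈ P.0#
  rootProduct∣⇒≈0 k bs {l} {f} (g , g*Π≈f) f0 l≤ =
    P.trans (P.sym g*Π≈f) (P.trans (P.*-congʳ g≈0) (P.zeroˡ (rootProduct k bs)))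
    where
    g≈0 : g P.≈ P.0#
    g≈0 = coeffwise λ i → cofactor-vanishes k bs g (vanishes-resp (P.trans (P.sym g*Π≈f) (P.*-comm g (rootProduct k bs))) f0) i
      (≡.subst (ℕ._≤ i) (≡.sym (ℕ.m≤n⇒m∸n≡0 l≤)) z≤n)

  -- One normal form serves two purposes: Z = X gives the coefficients and hence the degree, Z = X -
  -- b gives the order of vanishing at b.
  horner : Seq → ℕ → Poly → Poly
  horner u zero    Z = P.0#
  horner u (suc l) Z = const (u 0) P.+ Z P.* horner (λ t → u (suc t)) l Z

  horner-cong : ∀ {u v Z Z′} l → (∀ t → u t ≈ v t) → Z P.≈ Z′ → horner u l Z P.≈ horner v l Z′
  horner-cong zero    u≈v Z≈ = P.refl
  horner-cong (suc l) u≈v Z≈ = P.+-cong (const-cong (u≈v 0)) (P.*-cong Z≈ (horner-cong l (λ t → u≈v (suc t)) Z≈))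

  horner-+ : ∀ u v l Z → horner u l Z P.+ horner v l Z P.≈ horner (λ t → u t + v t) l Z
  horner-+ u v zero    Z = P.+-identityˡ P.0#
  horner-+ u v (suc l) Z = begin
    (const (u 0) P.+ Z P.* hu) P.+ (const (v 0) P.+ Z P.* hv)  ≈⟨ rearrange (const (u 0)) (const (v 0)) hu hv Z ⟩
    (const (u 0) P.+ const (v 0)) P.+ Z P.* (hu P.+ hv)        ≈⟨ P.+-cong (P.sym (const-+ (u 0) (v 0))) (P.*-congˡ (horner-+ (λ t → u (suc t)) (λ t → v (suc t)) l Z)) ⟩
    horner (λ t → u t + v t) (suc l) Z                         ∎
    where
    open import Relation.Binary.Reasoning.Setoid P.setoid
    hu = horner (λ t → u (suc t)) l Z
    hv = horner (λ t → v (suc t)) l Z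
    rearrange : ∀ a b x y Z → (a P.+ Z P.* x) P.+ (b P.+ Z P.* y) P.≈ (a P.+ b) P.+ Z P.* (x P.+ y)
    rearrange = PS.solve 5 (λ a b x y Z → (a PS.:+ Z PS.:* x) PS.:+ (b PS.:+ Z PS.:* y) PS.:= (a PS.:+ b) PS.:+ Z PS.:* (x PS.:+ y)) P.refl

  horner-scale : ∀ a u l Z → const a P.* horner u l Z P.≈ horner (λ t → a * u t) l Z
  horner-scale a u zero    Z = P.zeroʳ (const a)
  horner-scale a u (suc l) Z = begin
    const a P.* (const (u 0) P.+ Z P.* hu)              ≈⟨ rearrange (const a) (const (u 0)) Z hu ⟩
    const a P.* const (u 0) P.+ Z P.* (const a P.* hu)  ≈⟨ P.+-cong (P.sym (const-* a (u 0))) (P.*-congˡ (horner-scale a (λ t → u (suc t)) l Z)) ⟩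
    horner (λ t → a * u t) (suc l) Z                    ∎
    where
    open import Relation.Binary.Reasoning.Setoid P.setoid
    hu = horner (λ t → u (suc t)) l Z
    rearrange : ∀ a u Z x → a P.* (u P.+ Z P.* x) P.≈ a P.* u P.+ Z P.* (a P.* x)
    rearrange = PS.solve 4 (λ a u Z x → a PS.:* (u PS.:+ Z PS.:* x) PS.:= a PS.:* u PS.:+ Z PS.:* (a PS.:* x)) P.refl

  horner-zero : ∀ {u} l Z → (∀ t → u t ≈ 0#) → horner u l Z P.≈ P.0#
  horner-zero zero    Z u≈0 = P.refl
  horner-zero (suc l) Z u≈0 = P.trans (P.+-cong (P.trans (const-cong (u≈0 0)) const-0) (P.trans (P.*-congˡ (horner-zero l Z (λ t → u≈0 (suc t)))) (P.zeroʳ Z))) (P.+-identityˡ P.0#)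

  horner-extend : ∀ u l Z → u l ≈ 0# → horner u l Z P.≈ horner u (suc l) Z
  horner-extend u zero    Z u0≈0 = P.sym (P.trans (P.+-cong (P.trans (const-cong u0≈0) const-0) (P.zeroʳ Z)) (P.+-identityˡ P.0#))
  horner-extend u (suc l) Z ul≈0 = P.+-congˡ {const (u 0)} (P.*-congˡ {Z} (horner-extend (λ t → u (suc t)) l Z ul≈0))

  shift : Seq → Seq
  shift u zero    = 0#
  shift u (suc t) = u t

  horner-shift : ∀ u l Z → Z P.* horner u l Z P.≈ horner (shift u) (suc l) Z
  horner-shift u l Z = P.sym (P.trans (P.+-congʳ {Z P.* horner u l Z} const-0) (P.+-identityˡ _))

  ^∣horner : ∀ k {u} l Z → (∀ t → t ℕ.< k → u t ≈ 0#) → Z ^ k ∣ horner u l Z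
  ^∣horner zero    {u} l       Z u≈0 = horner u l Z , P.*-identityʳ (horner u l Z)
  ^∣horner (suc k)     zero    Z u≈0 = P.0# , P.zeroˡ (Z ^ suc k)
  ^∣horner (suc k) {u} (suc l) Z u≈0 with g , eq ← ^∣horner k {λ t → u (suc t)} l Z (λ t t<k → u≈0 (suc t) (s≤s t<k)) =
    g , (begin
      g P.* (Z P.* Z ^ k)                                     ≈⟨ rearrange g Z (Z ^ k) ⟩
      Z P.* (g P.* Z ^ k)                                     ≈⟨ P.*-congˡ {Z} eq ⟩
      Z P.* horner (λ t → u (suc t)) l Z                      ≈⟨ P.+-identityˡ (Z P.* horner (λ t → u (suc t)) l Z) ⟨
      P.0# P.+ Z P.* horner (λ t → u (suc t)) l Z             ≈⟨ P.+-congʳ {Z P.* horner (λ t → u (suc t)) l Z} (P.trans (const-cong (u≈0 0 (s≤s z≤n))) const-0) ⟨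
      horner u (suc l) Z                                      ∎)
    where
    open import Relation.Binary.Reasoning.Setoid P.setoid
    rearrange : ∀ g Z y → g P.* (Z P.* y) P.≈ Z P.* (g P.* y)
    rearrange = PS.solve 3 (λ g Z y → g PS.:* (Z PS.:* y) PS.:= Z PS.:* (g PS.:* y)) P.refl

  horner-X-< : ∀ u l n → n ℕ.< l → coeff (horner u l X) n ≈ u n
  horner-X-< u (suc l) zero    lt = trans (+-congˡ (X*-zero (horner (λ t → u (suc t)) l X))) (+-identityʳ _)
  horner-X-< u (suc l) (suc n) lt = trans (trans (+-identityˡ _) (X*-suc (horner (λ t → u (suc t)) l X) n)) (horner-X-< (λ t → u (suc t)) l n (s≤s⁻¹ lt))

  horner-X-≥ : ∀ u l → Vanishes l (coeff (horner u l X))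
  horner-X-≥ u zero    n       le = refl
  horner-X-≥ u (suc l) (suc n) le = trans (trans (+-identityˡ _) (X*-suc (horner (λ t → u (suc t)) l X) n)) (horner-X-≥ (λ t → u (suc t)) l n (s≤s⁻¹ le))

  open import Algebra.Properties.Semiring.Exp semiring using () renaming (_^_ to _^ᶜ_)
  open import Algebra.Properties.Semiring.Mult semiring using (×-homo-+) renaming (_×_ to _·_)
  open import Algebra.Properties.CommutativeSemigroup *-commutativeSemigroup using (x∙yz≈y∙xz)

  -- The coefficient of Z^t in (Z + s)^M. For t > M the truncated exponent is harmless, because the
  -- binomial coefficient is zero.
  binomialCoeff : Carrier → ℕ → Seq
  binomialCoeff s M t = ((M C t) · 1#) * s ^ᶜ (M ℕ.∸ t)

  binomialCoeff-> : ∀ s {M t} → M ℕ.< t → binomialCoeff s M t ≈ 0#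
  binomialCoeff-> s M<t = trans (*-congʳ (reflexive (≡.cong (_· 1#) (k>n⇒nCk≡0 M<t)))) (zeroˡ _)

  pascal : ∀ s M t → shift (binomialCoeff s M) t + s * binomialCoeff s M t ≈ binomialCoeff s (suc M) t
  pascal s M zero    = trans (+-identityˡ _) (x∙yz≈y∙xz _ _ _)
  pascal s M (suc t) = trans (+-congˡ shifted) (trans (sym (distribʳ _ _ _)) (*-congʳ (trans (sym (×-homo-+ 1# (M C t) (M C suc t))) (reflexive (≡.cong (_· 1#) (nCk+nC[k+1]≡[n+1]C[k+1] M t))))))
    where
    shifted : s * binomialCoeff s M (suc t) ≈ ((M C suc t) · 1#) * s ^ᶜ (M ℕ.∸ t)
    shifted with t ℕ.<? M
    ... | yes t<M = trans (x∙yz≈y∙xz _ _ _) (*-congˡ (reflexive (≡.cong (s ^ᶜ_) (≡.sym (ℕ.+-∸-assoc 1 t<M)))))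
    -- Truncated subtraction breaks s · s^(M-t-1) = s^(M-t) here, but both sides carry the factor
    -- C(M, t+1) = 0.
    ... | no  t≮M = trans (*-congˡ (binomialCoeff-> s M<1+t)) (trans (zeroʳ s)
                      (sym (trans (*-congʳ (reflexive (≡.cong (_· 1#) (k>n⇒nCk≡0 M<1+t)))) (zeroˡ _))))
      where M<1+t = s≤s (ℕ.≮⇒≥ t≮M)

  binomial-theorem : ∀ Z s M → (Z P.+ const s) ^ M P.≈ horner (binomialCoeff s M) (suc M) Z
  binomial-theorem Z s zero    = P.sym (P.trans (P.+-cong (const-cong (trans (*-identityʳ _) (+-identityʳ 1#))) (P.zeroʳ Z)) (P.+-identityʳ P.1#))
  binomial-theorem Z s (suc M) = begin
    (Z P.+ const s) P.* (Z P.+ const s) ^ M                               ≈⟨ P.*-congˡ {Z P.+ const s} (binomial-theorem Z s M) ⟩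
    (Z P.+ const s) P.* horner β (suc M) Z                                ≈⟨ P.distribʳ _ Z (const s) ⟩
    Z P.* horner β (suc M) Z P.+ const s P.* horner β (suc M) Z           ≈⟨ P.+-cong (horner-shift β (suc M) Z) (P.trans (P.*-congˡ {const s} (horner-extend β (suc M) Z (binomialCoeff-> s {M} ℕ.≤-refl))) (horner-scale s β (2 ℕ.+ M) Z)) ⟩
    horner (shift β) (2 ℕ.+ M) Z P.+ horner (λ t → s * β t) (2 ℕ.+ M) Z   ≈⟨ horner-+ (shift β) (λ t → s * β t) (2 ℕ.+ M) Z ⟩
    horner (λ t → shift β t + s * β t) (2 ℕ.+ M) Z                        ≈⟨ horner-cong (2 ℕ.+ M) (pascal s M) P.refl ⟩
    horner (binomialCoeff s (suc M)) (2 ℕ.+ M) Z                          ∎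
    where
    open import Relation.Binary.Reasoning.Setoid P.setoid
    β = binomialCoeff s M

-- Inversion is total with an arbitrary value at 0, so the weights below can be computed without
-- proofs that the nodes differ.
InvertsNonzero : {c ℓ : Level} (R : CommutativeRing c ℓ) → (CommutativeRing.Carrier R → CommutativeRing.Carrier R) → Set (c ⊔ ℓ)
InvertsNonzero R inv = ∀ {x} → ¬ x ≈ 0# → x * inv x ≈ 1#
  where open CommutativeRing R

-- Divided differences and the auxiliary polynomial

module Stepanov {c ℓ : Level} (R : CommutativeRing c ℓ)
  (inv : CommutativeRing.Carrier R → CommutativeRing.Carrier R) (inv-inverse : InvertsNonzero R inv) where

  open CommutativeRing R
  open Polynomials R
  open PolynomialProperties R
  open Comaximality polyRing
  open UniqueSetoid setoid using (Unique)
  open import Algebra.Properties.Ring ring using (-0#≈0#; x∙y⁻¹≈ε⇒x≈y)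
  open import Algebra.Properties.Semiring.Exp semiring using (_^_; ^-congˡ; ^-homo-*)
  open import Algebra.Properties.Semiring.Mult semiring using (×-homo-1) renaming (_×_ to _·_)
  open import Algebra.Properties.Semiring.Exp P.semiring using () renaming (_^_ to _^ᴾ_; ^-congˡ to ^ᴾ-congˡ)
  open import Algebra.Properties.Semiring.Divisibility P.semiring using (_∣_; _,_; ∣-respʳ)

  -‿≉0 : ∀ {x y} → x ≉ y → ¬ x + - y ≈ 0#
  -‿≉0 x≉y x-y≈0 = x≉y (x∙y⁻¹≈ε⇒x≈y _ _ x-y≈0)

  -- The difference (X - b) - (X - a) is the constant a - b, which is invertible.
  X-‿comaximal : ∀ {a b} → a ≉ b → Comaximal (X- a) (X- b)
  X-‿comaximal {a} {b} a≉b = P.- W , W , (begin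
    P.- W P.* (X- a) P.+ W P.* (X- b)                        ≈⟨ P.+-congˡ {P.- W P.* (X- a)} (P.*-congˡ {W} X-b≈) ⟩
    P.- W P.* (X- a) P.+ W P.* ((X- a) P.+ const (a + - b))  ≈⟨ rearrange (P.- W) W (X- a) (const (a + - b)) ⟩
    (P.- W P.+ W) P.* (X- a) P.+ W P.* const (a + - b)       ≈⟨ P.+-cong (P.trans (P.*-congʳ {X- a} (P.-‿inverseˡ W)) (P.zeroˡ (X- a))) (P.sym (const-* (inv (a + - b)) (a + - b))) ⟩
    P.0# P.+ const (inv (a + - b) * (a + - b))               ≈⟨ P.+-identityˡ (const (inv (a + - b) * (a + - b))) ⟩
    const (inv (a + - b) * (a + - b))                        ≈⟨ const-cong (trans (*-comm _ _) (inv-inverse (-‿≉0 a≉b))) ⟩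
    P.1#                                                     ∎)
    where
    open import Relation.Binary.Reasoning.Setoid P.setoid
    W = const (inv (a + - b))
    rearrange : ∀ u w x y → u P.* x P.+ w P.* (x P.+ y) P.≈ (u P.+ w) P.* x P.+ w P.* y
    rearrange = PS.solve 4 (λ u w x y → u PS.:* x PS.:+ w PS.:* (x PS.:+ y) PS.:= (u PS.:+ w) PS.:* x PS.:+ w PS.:* y) P.refl
    X-b≈ : X- b P.≈ (X- a) P.+ const (a + - b)
    X-b≈ = P.trans (P.+-congˡ {X} (P.trans (const-cong -b≈) (const-+ (- a) (a + - b)))) (P.sym (P.+-assoc X (const (- a)) (const (a + - b))))
      where
      -b≈ : - b ≈ - a + (a + - b)
      -b≈ = sym (trans (sym (+-assoc _ _ _)) (trans (+-congʳ (-‿inverseˡ a)) (+-identityˡ (- b))))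

  rootProduct-comaximal : ∀ k {b bs} → All (b ≉_) bs → Comaximal (rootProduct k bs) ((X- b) ^ᴾ k)
  rootProduct-comaximal k {b} []           = comaximal-1 ((X- b) ^ᴾ k)
  rootProduct-comaximal k     (b≉b′ ∷ b≉bs) =
    comaximal-* (comaximal-^ k (comaximal-sym (comaximal-^ k (X-‿comaximal b≉b′)))) (rootProduct-comaximal k b≉bs)

  rootProduct-∣ : ∀ k {bs f} → Unique bs → All (λ b → (X- b) ^ᴾ k ∣ f) bs → rootProduct k bs ∣ f
  rootProduct-∣ k {[]} {f} _ _ = f , P.*-identityʳ f
  rootProduct-∣ k (b∉bs ∷ unique) (b∣f ∷ bs∣f) =
    comaximal-∣-* (comaximal-sym (rootProduct-comaximal k b∉bs)) b∣f (rootProduct-∣ k unique bs∣f)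

  Weighted : Set c
  Weighted = List (Carrier × Carrier)

  weightedSum : Weighted → (Carrier → Carrier) → Carrier
  weightedSum []            g = 0#
  weightedSum ((w , a) ∷ W) g = w * g a + weightedSum W g

  weightedSum-cong : ∀ {W g h} → All (λ wa → g (proj₂ wa) ≈ h (proj₂ wa)) W → weightedSum W g ≈ weightedSum W h
  weightedSum-cong []           = refl
  weightedSum-cong (g≈h ∷ gs≈hs) = +-cong (*-congˡ g≈h) (weightedSum-cong gs≈hs)

  weightedSum-scale : ∀ W x g → weightedSum W (λ a → x * g a) ≈ x * weightedSum W g
  weightedSum-scale []            x g = sym (zeroʳ x)
  weightedSum-scale ((w , a) ∷ W) x g = trans (+-congˡ (weightedSum-scale W x g)) (rearrange w x (g a) (weightedSum W g))
    where
    rearrange : ∀ w x y z → w * (x * y) + x * z ≈ x * (w * y + z)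
    rearrange = CS.solve 4 (λ w x y z → w CS.:* (x CS.:* y) CS.:+ x CS.:* z CS.:= x CS.:* (w CS.:* y CS.:+ z)) refl

  moment : Weighted → Carrier → ℕ → Carrier
  moment W b e = weightedSum W (λ a → (a + b) ^ e)

  divideWeights : Carrier → Weighted → Weighted
  divideWeights a₀ = map λ (w , a) → w * inv (a + - a₀) , a

  -- The old functional is applied to the difference quotient (g(a) - g(a₀))/(a - a₀); the weight at
  -- a₀ collects the terms with g(a₀).
  extendWeights : Carrier → Weighted → Weighted
  extendWeights a₀ W = (- weightedSum (divideWeights a₀ W) (λ _ → 1#) , a₀) ∷ divideWeights a₀ W

  -- Divided differences: the functional g ↦ g[a₁,…,aₖ].
  weights : Carrier → List Carrier → Weighted
  weights a []        = (1# , a) ∷ []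
  weights a₀ (a ∷ as) = extendWeights a₀ (weights a as)

  divideWeights-All : ∀ {p} {Q : Carrier → Set p} a₀ {W} → All (λ wa → Q (proj₂ wa)) W → All (λ wa → Q (proj₂ wa)) (divideWeights a₀ W)
  divideWeights-All a₀ = All.map⁺

  weights-All : ∀ {p} {Q : Carrier → Set p} {a as} → All Q (a ∷ as) → All (λ wa → Q (proj₂ wa)) (weights a as)
  weights-All (q ∷ [])         = q ∷ []
  weights-All (q ∷ qs@(_ ∷ _)) = q ∷ divideWeights-All _ (weights-All qs)

  -- Write one factor a + b as (a₀ + b) + (a - a₀): the second part cancels the division of the
  -- weight and restores the moment of W.
  divideWeights-moment : ∀ {a₀ W} → All (λ wa → a₀ ≉ proj₂ wa) W → ∀ b e →
    moment (divideWeights a₀ W) b (suc e) ≈ (a₀ + b) * moment (divideWeights a₀ W) b e + moment W b e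
  divideWeights-moment {a₀} [] b e = sym (trans (+-identityʳ _) (zeroʳ _))
  divideWeights-moment {a₀} {(w , a) ∷ W} (a₀≉a ∷ a₀≉) b e = begin
    w * i * ((a + b) * z) + moment W′ b (suc e)                              ≈⟨ +-cong (*-congˡ (*-congʳ a+b≈)) (divideWeights-moment a₀≉ b e) ⟩
    w * i * (((a₀ + b) + δ) * z) + ((a₀ + b) * moment W′ b e + moment W b e) ≈⟨ rearrange w i (a₀ + b) δ z (moment W′ b e) (moment W b e) ⟩
    (a₀ + b) * (w * i * z + moment W′ b e) + (w * (δ * i) * z + moment W b e) ≈⟨ +-congˡ (+-congʳ (*-congʳ (trans (*-congˡ (inv-inverse (-‿≉0 λ a≈a₀ → a₀≉a (sym a≈a₀)))) (*-identityʳ w)))) ⟩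
    (a₀ + b) * (w * i * z + moment W′ b e) + (w * z + moment W b e)           ∎
    where
    open import Relation.Binary.Reasoning.Setoid setoid
    W′ = divideWeights a₀ W
    δ = a + - a₀
    i = inv δ
    z = (a + b) ^ e
    a+b≈ : a + b ≈ (a₀ + b) + δ
    a+b≈ = sym (begin
      (a₀ + b) + (a + - a₀)  ≈⟨ CS.solve 4 (λ x y z u → (x CS.:+ y) CS.:+ (z CS.:+ u) CS.:= (z CS.:+ y) CS.:+ (x CS.:+ u)) refl a₀ b a (- a₀) ⟩
      (a + b) + (a₀ + - a₀)  ≈⟨ +-congˡ (-‿inverseʳ a₀) ⟩
      (a + b) + 0#           ≈⟨ +-identityʳ _ ⟩
      a + b                  ∎)
    rearrange : ∀ w i s δ z m n → w * i * ((s + δ) * z) + (s * m + n) ≈ s * (w * i * z + m) + (w * (δ * i) * z + n)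
    rearrange = CS.solve 7 (λ w i s δ z m n → w CS.:* i CS.:* ((s CS.:+ δ) CS.:* z) CS.:+ (s CS.:* m CS.:+ n) CS.:= s CS.:* (w CS.:* i CS.:* z CS.:+ m) CS.:+ (w CS.:* (δ CS.:* i) CS.:* z CS.:+ n)) refl

  moment-suc : ∀ {a₀ a as} → All (a₀ ≉_) (a ∷ as) → ∀ b e →
    moment (weights a₀ (a ∷ as)) b (suc e) ≈ (a₀ + b) * moment (weights a₀ (a ∷ as)) b e + moment (weights a as) b e
  moment-suc {a₀} {a} {as} a₀∉ b e =
    trans (+-congˡ (divideWeights-moment (weights-All a₀∉) b e))
          (CS.solve 5 (λ w s z m n → w CS.:* (s CS.:* z) CS.:+ (s CS.:* m CS.:+ n) CS.:= s CS.:* (w CS.:* z CS.:+ m) CS.:+ n) refl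
            _ (a₀ + b) ((a₀ + b) ^ e) _ _)

  moment-0 : ∀ a₀ a as b → moment (weights a₀ (a ∷ as)) b 0 ≈ 0#
  moment-0 a₀ a as b = trans (+-congʳ (*-identityʳ _)) (-‿inverseˡ _)

  moment-< : ∀ {a as} → Unique (a ∷ as) → ∀ b e → e ℕ.< length as → moment (weights a as) b e ≈ 0#
  moment-< {a₀} {a ∷ as} unique        b zero    lt = moment-0 a₀ a as b
  moment-< {a₀} {a ∷ as} (a₀∉ ∷ unique) b (suc e) lt = begin
    moment (weights a₀ (a ∷ as)) b (suc e)                                              ≈⟨ moment-suc a₀∉ b e ⟩
    (a₀ + b) * moment (weights a₀ (a ∷ as)) b e + moment (weights a as) b e         ≈⟨ +-cong (*-congˡ (moment-< (a₀∉ ∷ unique) b e (ℕ.<-trans (ℕ.n<1+n e) lt))) (moment-< unique b e (s≤s⁻¹ lt)) ⟩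
    (a₀ + b) * 0# + 0#                                                                    ≈⟨ trans (+-identityʳ _) (zeroʳ _) ⟩
    0#                                                                                    ∎
    where open import Relation.Binary.Reasoning.Setoid setoid

  -- A divided difference on k nodes returns the leading coefficient of a polynomial of degree k -
  -- 1, and (Y + b)^(k-1) is monic in Y for every b.
  moment-≡ : ∀ {a as} → Unique (a ∷ as) → ∀ b → moment (weights a as) b (length as) ≈ 1#
  moment-≡ {a} {[]} _ b = trans (+-identityʳ _) (*-identityʳ 1#)
  moment-≡ {a₀} {a ∷ as} (a₀∉ ∷ unique) b = begin
    moment (weights a₀ (a ∷ as)) b (suc (length as))                                                       ≈⟨ moment-suc a₀∉ b (length as) ⟩
    (a₀ + b) * moment (weights a₀ (a ∷ as)) b (length as) + moment (weights a as) b (length as)         ≈⟨ +-cong (*-congˡ (moment-< (a₀∉ ∷ unique) b (length as) ℕ.≤-refl)) (moment-≡ unique b) ⟩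
    (a₀ + b) * 0# + 1#                                                                                       ≈⟨ trans (+-congʳ (zeroʳ _)) (+-identityˡ 1#) ⟩
    1#                                                                                                       ∎
    where open import Relation.Binary.Reasoning.Setoid setoid

  powerSum : Weighted → ℕ → Poly
  powerSum []            M = P.0#
  powerSum ((w , a) ∷ W) M = const w P.* (X P.+ const a) ^ᴾ M P.+ powerSum W M

  -- Since X + a = (X - b) + (a + b), the binomial theorem expands every summand around the same
  -- point b.
  powerSum-horner : ∀ W M b → powerSum W M P.≈ horner (λ t → weightedSum W (λ a → binomialCoeff (a + b) M t)) (suc M) (X- b)
  powerSum-horner []            M b = P.sym (horner-zero (suc M) (X- b) (λ _ → refl))
  powerSum-horner ((w , a) ∷ W) M b = begin
    const w P.* (X P.+ const a) ^ᴾ M P.+ powerSum W M                        ≈⟨ P.+-cong (P.*-congˡ {const w} (P.trans (^ᴾ-congˡ M X+a≈) (binomial-theorem (X- b) (a + b) M))) (powerSum-horner W M b) ⟩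
    const w P.* horner β (suc M) (X- b) P.+ horner u (suc M) (X- b)          ≈⟨ P.+-congʳ {horner u (suc M) (X- b)} (horner-scale w β (suc M) (X- b)) ⟩
    horner (λ t → w * β t) (suc M) (X- b) P.+ horner u (suc M) (X- b)        ≈⟨ horner-+ (λ t → w * β t) u (suc M) (X- b) ⟩
    horner (λ t → w * β t + u t) (suc M) (X- b)                              ∎
    where
    open import Relation.Binary.Reasoning.Setoid P.setoid
    β = binomialCoeff (a + b) M
    u : Seq
    u t = weightedSum W (λ a → binomialCoeff (a + b) M t)
    X+a≈ : X P.+ const a P.≈ (X- b) P.+ const (a + b)
    X+a≈ = P.trans (P.+-congˡ {X} (P.trans (const-cong a≈) (const-+ (- b) (a + b)))) (P.sym (P.+-assoc X (const (- b)) (const (a + b))))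
      where
      a≈ : a ≈ - b + (a + b)
      a≈ = sym (trans (+-congˡ (+-comm a b)) (trans (sym (+-assoc _ _ _)) (trans (+-congʳ (-‿inverseˡ b)) (+-identityˡ a))))

  -- Σ wᵢ (X + aᵢ)^(m+j) − 1 has degree m, because the first j moments of the weights
  -- vanish, and it vanishes to order j + 1 at each b ∈ bs.
  stepanov : ∀ m j as bs → Unique as → Unique bs → length as ≡ suc j → 1 ℕ.≤ m →
             All (λ b → All (λ a → (a + b) ^ m ≈ 1#) as) bs →
             ¬ ((m ℕ.+ j) C m) · 1# ≈ 0# → suc j ℕ.* length bs ℕ.≤ m
  stepanov m j as@(a₀ ∷ as′) bs as-unique bs-unique ≡.refl 1≤m sums≈1 C≉0 = ℕ.≮⇒≥ λ m< →
    C≉0 (trans (sym f-at-m) (rootProduct∣⇒≈0 (suc j) bs (rootProduct-∣ (suc j) bs-unique (All.map roots sums≈1)) f-vanishes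
      (≡.subst (suc m ℕ.≤_) (ℕ.*-comm (suc j) (length bs)) m<) at m))
    where
    M = m ℕ.+ j
    W = weights a₀ as′
    u : Carrier → Seq
    u b t = weightedSum W (λ a → binomialCoeff (a + b) M t)
    u≈ : ∀ b t → u b t ≈ ((M C t) · 1#) * moment W b (M ℕ.∸ t)
    u≈ b t = weightedSum-scale W ((M C t) · 1#) (λ a → (a + b) ^ (M ℕ.∸ t))
    f = powerSum W M P.+ const (- 1#)

    -- The expansion at b = 0 shows the true coefficients; the subtracted 1 affects only the
    -- constant one.
    f-coeff : ∀ n → 1 ℕ.≤ n → coeff f n ≈ coeff (horner (u 0#) (suc M) X) n
    f-coeff (suc n) _ = trans (+-identityʳ _) (P.trans (powerSum-horner W M 0#) (horner-cong {u 0#} (suc M) (λ _ → refl) X-0≈X) at suc n)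
      where
      X-0≈X : X- 0# P.≈ X
      X-0≈X = P.trans (P.+-congˡ {X} (P.trans (const-cong -0#≈0#) const-0)) (P.+-identityʳ X)

    f-vanishes : Vanishes (suc m) (coeff f)
    f-vanishes (suc n) m≤n with suc n ℕ.<? suc M
    ... | no n≮M = trans (f-coeff (suc n) (s≤s z≤n)) (horner-X-≥ (u 0#) (suc M) (suc n) (ℕ.≮⇒≥ n≮M))
    ... | yes n<M = begin
      coeff f (suc n)                                          ≈⟨ f-coeff (suc n) (s≤s z≤n) ⟩
      coeff (horner (u 0#) (suc M) X) (suc n)                  ≈⟨ horner-X-< (u 0#) (suc M) (suc n) n<M ⟩
      u 0# (suc n)                                             ≈⟨ u≈ 0# (suc n) ⟩
      ((M C suc n) · 1#) * moment W 0# (M ℕ.∸ suc n)           ≈⟨ *-congˡ (moment-< as-unique 0# (M ℕ.∸ suc n) M∸<j) ⟩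
      ((M C suc n) · 1#) * 0#                                  ≈⟨ zeroʳ _ ⟩
      0#                                                       ∎
      where
      open import Relation.Binary.Reasoning.Setoid setoid
      M∸<j : M ℕ.∸ suc n ℕ.< j
      M∸<j = ≡.subst (M ℕ.∸ suc n ℕ.<_) (ℕ.m+n∸m≡n m j) (ℕ.∸-monoʳ-< m≤n (s≤s⁻¹ n<M))

    f-at-m : coeff f m ≈ (M C m) · 1#
    f-at-m = begin
      coeff f m                                  ≈⟨ f-coeff m 1≤m ⟩
      coeff (horner (u 0#) (suc M) X) m          ≈⟨ horner-X-< (u 0#) (suc M) m (s≤s (ℕ.m≤m+n m j)) ⟩
      u 0# m                                     ≈⟨ u≈ 0# m ⟩
      ((M C m) · 1#) * moment W 0# (M ℕ.∸ m)     ≈⟨ *-congˡ (trans (reflexive (≡.cong (moment W 0#) (ℕ.m+n∸m≡n m j))) (moment-≡ as-unique 0#)) ⟩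
      ((M C m) · 1#) * 1#                        ≈⟨ *-identityʳ _ ⟩
      (M C m) · 1#                               ∎
      where open import Relation.Binary.Reasoning.Setoid setoid

    roots : ∀ {b} → All (λ a → (a + b) ^ m ≈ 1#) as → (X- b) ^ᴾ suc j ∣ f
    roots {b} sums = ∣-respʳ (P.sym f≈) (^∣horner (suc j) (suc M) (X- b) u′≈0)
      where
      u′ : Seq
      u′ zero    = u b 0 + - 1#
      u′ (suc t) = u b (suc t)
      f≈ : f P.≈ horner u′ (suc M) (X- b)
      f≈ = P.trans (P.+-congʳ {const (- 1#)} (powerSum-horner W M b)) (P.trans (PS.solve 3 (λ x y z → (x PS.:+ y) PS.:+ z PS.:= (x PS.:+ z) PS.:+ y) P.refl (const (u b 0)) Zh (const (- 1#))) (P.+-congʳ {Zh} (P.sym (const-+ (u b 0) (- 1#)))))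
        where Zh = (X- b) P.* horner (λ t → u b (suc t)) M (X- b)
      -- This is where (a + b)^m = 1 enters: it lowers the exponents from m + j - t to j - t, the
      -- range governed by the weights.
      moment-shift : ∀ e → moment W b (m ℕ.+ e) ≈ moment W b e
      moment-shift e = weightedSum-cong (All.map (λ {wa} eq → trans (^-homo-* (proj₂ wa + b) m e) (trans (*-congʳ eq) (*-identityˡ _))) (weights-All sums))
      u≈′ : ∀ t → t ℕ.≤ j → u b t ≈ ((M C t) · 1#) * moment W b (j ℕ.∸ t)
      u≈′ t t≤j = trans (u≈ b t) (*-congˡ (trans (reflexive (≡.cong (moment W b) (ℕ.+-∸-assoc m t≤j))) (moment-shift (j ℕ.∸ t))))
      u′≈0 : ∀ t → t ℕ.< suc j → u′ t ≈ 0#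
      -- At t = 0 the moment of order j is 1, which the subtracted 1 cancels; for 0 < t ≤ j the
      -- moments themselves vanish.
      u′≈0 zero    _  = trans (+-congʳ (trans (u≈′ 0 z≤n) (trans (*-cong (×-homo-1 1#) (moment-≡ as-unique b)) (*-identityˡ 1#)))) (-‿inverseʳ 1#)
      u′≈0 (suc t) lt = trans (u≈′ (suc t) (s≤s⁻¹ lt)) (trans (*-congˡ (moment-< as-unique b (j ℕ.∸ suc t) (ℕ.∸-monoʳ-< {o = 0} (s≤s z≤n) (s≤s⁻¹ lt)))) (zeroʳ _))

-- Counting with lists free of repetition

module UniqueLists {a ℓ : Level} (S : Setoid a ℓ) where

  open Setoid S
  open UniqueSetoid S using (Unique)
  open MembershipSetoid S using (_∈_)
  open PermutationSetoid S using (_↭_; ↭-refl; ↭-sym; ↭-trans; ↭-prep; ↭-swap; prep)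
  open PermutationProperties S using (xs↭ys⇒|xs|≡|ys|; ∈-resp-↭)

  -- Two members of such a list are equal exactly when they are found at the same position, so an
  -- enumeration of the field decides equality.
  ≈-dec-∈ : ∀ {x y xs} → Unique xs → x ∈ xs → y ∈ xs → Dec (x ≈ y)
  ≈-dec-∈ u        (here x≈)  (here y≈)  = yes (trans x≈ (sym y≈))
  ≈-dec-∈ u        (here x≈)  (there y∈) = no λ x≈y → UniqueProperties.Unique[x∷xs]⇒x∉xs S u (MembershipProperties.∈-resp-≈ S (trans (sym x≈y) x≈) y∈)
  ≈-dec-∈ u        (there x∈) (here y≈)  = no λ x≈y → UniqueProperties.Unique[x∷xs]⇒x∉xs S u (MembershipProperties.∈-resp-≈ S (trans x≈y y≈) x∈)
  ≈-dec-∈ (_ ∷ u)  (there x∈) (there y∈) = ≈-dec-∈ u x∈ y∈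

  ∈⇒↭∷ : ∀ {x xs} → x ∈ xs → ∃ λ ys → xs ↭ x ∷ ys
  ∈⇒↭∷ {xs = y ∷ xs} (here x≈y) = xs , prep (sym x≈y) ↭-refl
  ∈⇒↭∷ {x} {y ∷ _}   (there x∈) with ys , xs↭ ← ∈⇒↭∷ x∈ = y ∷ ys , ↭-trans (↭-prep y xs↭) (↭-swap y x ↭-refl)

  -- The pigeonhole principle; it turns an injective map of a finite list into itself into a
  -- permutation.
  unique-⊆⇒↭ : ∀ {xs ys} → Unique xs → All (_∈ ys) xs → length ys ℕ.≤ length xs → xs ↭ ys
  unique-⊆⇒↭ {ys = []} []         []          le = ↭-refl
  unique-⊆⇒↭           (x∉ ∷ u) (x∈ys ∷ xs⊆) le with ys′ , ys↭ ← ∈⇒↭∷ x∈ys =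
    ↭-trans (↭-prep _ (unique-⊆⇒↭ u (All.zipWith drop (x∉ , xs⊆)) (s≤s⁻¹ (≡.subst (ℕ._≤ _) (xs↭ys⇒|xs|≡|ys| ys↭) le)))) (↭-sym ys↭)
    where
    drop : ∀ {z} → _ × _ → z ∈ ys′
    drop (x≉z , z∈ys) with ∈-resp-↭ ys↭ z∈ys
    ... | here z≈x = contradiction (sym z≈x) x≉z
    ... | there z∈ = z∈

  length-filter-∁ : ∀ {p} {P : Pred Carrier p} (P? : Decidable P) xs → length xs ≡ length (filter P? xs) ℕ.+ length (filter (∁? P?) xs)
  length-filter-∁ P? xs = ≡.trans (xs↭ys⇒|xs|≡|ys| (PermutationProperties.partition-↭ S P? xs))
    (≡.trans (length-++ (proj₁ (partition P? xs))) (≡.cong (λ yz → length (proj₁ yz) ℕ.+ length (proj₂ yz)) (partition-defn P? xs)))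

  -- Removing the fibre over the first y, at most d elements, leaves a list that maps into the
  -- remaining ys.
  length≤fibres : ∀ {p} {P : Pred Carrier p} (_≟_ : ∀ x y → Dec (x ≈ y)) (f : Carrier → Carrier) d →
    (∀ y zs → Unique zs → All P zs → All (λ z → f z ≈ y) zs → length zs ℕ.≤ d) →
    ∀ xs ys → Unique xs → All P xs → All (λ x → f x ∈ ys) xs → length xs ℕ.≤ length ys ℕ.* d
  length≤fibres _≟_ f d fibre≤ []       []       _ _ _ = z≤n
  length≤fibres _≟_ f d fibre≤ (_ ∷ _) []       _ _ (() ∷ _)
  length≤fibres {P = P} _≟_ f d fibre≤ xs (y ∷ ys) u Pxs fxs∈ =
    ≡.subst (ℕ._≤ suc (length ys) ℕ.* d) (≡.sym (length-filter-∁ y? xs))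
      (ℕ.+-mono-≤
        (fibre≤ y (filter y? xs) (UniqueProperties.filter⁺ S y? u) (All.filter⁺ y? Pxs) (All.all-filter y? xs))
        (length≤fibres {P = P} _≟_ f d fibre≤ (filter (∁? y?) xs) ys (UniqueProperties.filter⁺ S (∁? y?) u) (All.filter⁺ (∁? y?) Pxs)
          (All.zipWith drop (All.all-filter (∁? y?) xs , All.filter⁺ (∁? y?) fxs∈))))
    where
    y? : ∀ x → Dec (f x ≈ y)
    y? x = f x ≟ y
    drop : ∀ {x} → ¬ f x ≈ y × f x ∈ y ∷ ys → f x ∈ ys
    drop (fx≉y , here fx≈y) = contradiction fx≈y fx≉y
    drop (_    , there fx∈) = fx∈

-- Finite fields: Fermat's theorem, characteristic, roots of unity

module FiniteField (F : CommutativeRing 0ℓ 0ℓ) (q : ℕ) (isFiniteField : IsFiniteField F q) where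

  open CommutativeRing F
  open IsFiniteField isFiniteField
  open UniqueLists setoid
  open UniqueSetoid setoid using (Unique)
  open MembershipSetoid setoid using (_∈_)
  open PermutationSetoid setoid using (_↭_)
  open PermutationProperties setoid using (xs↭ys⇒|xs|≡|ys|; ∈-resp-↭; Unique-resp-↭; foldr-commMonoid)
  open import Algebra.Properties.Ring ring using (+-cancelˡ)
  open import Algebra.Properties.Semiring.Exp semiring using (_^_; ^-congˡ; ^-assocʳ)
  open import Algebra.Properties.CommutativeSemiring.Exp commutativeSemiring using (^-distrib-*)
  open import Algebra.Properties.Semiring.Mult semiring using (×1-homo-*; ×-homo-1) renaming (_×_ to _·_)
  open import Relation.Binary.Reasoning.Setoid setoid
  import Algebra.Solver.Ring.NaturalCoefficients.Default commutativeSemiring as CS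

  infix 4 _≟_
  _≟_ : ∀ x y → Dec (x ≈ y)
  x ≟ y = ≈-dec-∈ distinct (complete x) (complete y)

  inv : Carrier → Carrier
  inv x with x ≟ 0#
  ... | yes _   = 0#
  ... | no  x≉0 = proj₁ (inverse x x≉0)

  inv-inverse : ∀ {x} → ¬ x ≈ 0# → x * inv x ≈ 1#
  inv-inverse {x} x≉0 with x ≟ 0#
  ... | yes x≈0 = contradiction x≈0 x≉0
  ... | no  x≉0 = proj₂ (inverse x x≉0)

  *-cancelˡ-≉0 : ∀ {x y z} → ¬ x ≈ 0# → x * y ≈ x * z → y ≈ z
  *-cancelˡ-≉0 {x} {y} {z} x≉0 xy≈xz = trans (sym (undo y)) (trans (*-congˡ xy≈xz) (undo z))
    where
    undo : ∀ w → inv x * (x * w) ≈ w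
    undo w = begin
      inv x * (x * w)  ≈⟨ *-assoc (inv x) x w ⟨
      inv x * x * w    ≈⟨ *-congʳ (trans (*-comm (inv x) x) (inv-inverse x≉0)) ⟩
      1# * w           ≈⟨ *-identityˡ w ⟩
      w                ∎

  *-≉0 : ∀ {x y} → ¬ x ≈ 0# → ¬ y ≈ 0# → ¬ x * y ≈ 0#
  *-≉0 {x} x≉0 y≉0 xy≈0 = y≉0 (*-cancelˡ-≉0 x≉0 (trans xy≈0 (sym (zeroʳ x))))

  0∷units : ∃ λ us → elements ↭ 0# ∷ us
  0∷units = ∈⇒↭∷ (complete 0#)

  units : List Carrier
  units = proj₁ 0∷units

  length-units : suc (length units) ≡ q
  length-units = ≡.trans (≡.sym (xs↭ys⇒|xs|≡|ys| (proj₂ 0∷units))) card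

  0∷units-unique : Unique (0# ∷ units)
  0∷units-unique = Unique-resp-↭ (proj₂ 0∷units) distinct

  units-unique : Unique units
  units-unique with _ ∷ u ← 0∷units-unique = u

  units-≉0 : All (λ x → ¬ x ≈ 0#) units
  units-≉0 with 0≉ ∷ _ ← 0∷units-unique = All.map (λ 0≉x x≈0 → 0≉x (sym x≈0)) 0≉

  ≉0⇒∈units : ∀ {x} → ¬ x ≈ 0# → x ∈ units
  ≉0⇒∈units {x} x≉0 with ∈-resp-↭ (proj₂ 0∷units) (complete x)
  ... | here x≈0 = contradiction x≈0 x≉0
  ... | there x∈ = x∈

  -- Multiplication by x permutes the units, so their product is unchanged by the factor x^(q-1) and
  -- can be cancelled.
  fermat : ∀ {x} → ¬ x ≈ 0# → x ^ length units ≈ 1#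
  fermat {x} x≉0 = *-cancelˡ-≉0 (product-≉0 units-≉0) (begin
    product units * x ^ length units  ≈⟨ *-comm _ _ ⟩
    x ^ length units * product units  ≈⟨ product-map units ⟨
    product (map (x *_) units)        ≈⟨ foldr-commMonoid *-isCommutativeMonoid permuted ⟩
    product units                     ≈⟨ *-identityʳ _ ⟨
    product units * 1#                ∎)
    where
    product : List Carrier → Carrier
    product = foldr _*_ 1#
    product-≉0 : ∀ {xs} → All (λ x → ¬ x ≈ 0#) xs → ¬ product xs ≈ 0#
    product-≉0 []         = nontrivial
    product-≉0 (x≉0 ∷ xs) = *-≉0 x≉0 (product-≉0 xs)
    product-map : ∀ xs → product (map (x *_) xs) ≈ x ^ length xs * product xs
    product-map []       = sym (*-identityˡ 1#)
    product-map (y ∷ xs) = trans (*-congˡ (product-map xs))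
      (CS.solve 4 (λ x y z w → (x CS.:* y) CS.:* (z CS.:* w) CS.:= (x CS.:* z) CS.:* (y CS.:* w)) refl x y (x ^ length xs) (product xs))
    permuted : map (x *_) units ↭ units
    permuted = unique-⊆⇒↭ (UniqueProperties.map⁺ setoid setoid (*-cancelˡ-≉0 x≉0) units-unique)
      (All.map⁺ (All.map (λ y≉0 → ≉0⇒∈units (*-≉0 x≉0 y≉0)) units-≉0))
      (ℕ.≤-reflexive (≡.sym (length-map (x *_) units)))

  -- The additive analogue: translation by 1 permutes the field, and the sum of all elements is
  -- cancelled.
  q·1≈0 : q · 1# ≈ 0#
  q·1≈0 = +-cancelʳ′ (begin
    q · 1# + sum elements                ≈⟨ +-congʳ (reflexive (≡.cong (_· 1#) card)) ⟨
    length elements · 1# + sum elements  ≈⟨ sum-map elements ⟨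
    sum (map (1# +_) elements)           ≈⟨ foldr-commMonoid +-isCommutativeMonoid permuted ⟩
    sum elements                         ≈⟨ +-identityˡ _ ⟨
    0# + sum elements                    ∎)
    where
    sum : List Carrier → Carrier
    sum = foldr _+_ 0#
    +-cancelʳ′ : ∀ {x y z} → x + z ≈ y + z → x ≈ y
    +-cancelʳ′ {x} {y} {z} eq = +-cancelˡ z x y (trans (+-comm z x) (trans eq (+-comm y z)))
    sum-map : ∀ xs → sum (map (1# +_) xs) ≈ length xs · 1# + sum xs
    sum-map []       = sym (+-identityˡ 0#)
    sum-map (y ∷ xs) = trans (+-congˡ (sum-map xs))
      (CS.solve 4 (λ x y z w → (x CS.:+ y) CS.:+ (z CS.:+ w) CS.:= (x CS.:+ z) CS.:+ (y CS.:+ w)) refl 1# y (length xs · 1#) (sum xs))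
    permuted : map (1# +_) elements ↭ elements
    permuted = unique-⊆⇒↭ (UniqueProperties.map⁺ setoid setoid (+-cancelˡ 1# _ _) distinct)
      (All.map⁺ (All.universal (λ x → complete (1# + x)) elements))
      (ℕ.≤-reflexive (≡.sym (length-map (1# +_) elements)))

  ·1-multiple : ∀ {a} x → a · 1# ≈ 0# → (x ℕ.* a) · 1# ≈ 0#
  ·1-multiple {a} x a≈0 = trans (×1-homo-* x a) (trans (*-congˡ a≈0) (zeroʳ _))

  consecutive : ∀ {a b} → a · 1# ≈ 0# → b · 1# ≈ 0# → suc a ≢ b
  consecutive a≈0 b≈0 ≡.refl = nontrivial (trans (sym (trans (+-congˡ a≈0) (+-identityʳ 1#))) b≈0)

  module _ {p n : ℕ} (p-prime : Prime p) (q≡pⁿ : q ≡ p ℕ.^ n) where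

    p·1≈0 : p · 1# ≈ 0#
    p·1≈0 = go n (≡.subst (λ x → x · 1# ≈ 0#) q≡pⁿ q·1≈0)
      where
      go : ∀ n → (p ℕ.^ n) · 1# ≈ 0# → p · 1# ≈ 0#
      go zero    1≈0 = contradiction (trans (sym (×-homo-1 1#)) 1≈0) nontrivial
      go (suc n) eq with p · 1# ≟ 0#
      ... | yes p≈0 = p≈0
      ... | no  p≉0 = go n (*-cancelˡ-≉0 p≉0 (trans (sym (×1-homo-* p (p ℕ.^ n))) (trans eq (sym (zeroʳ _)))))

    -- This carries p ∤ C(m+j, m) into the field. If c and p both mapped to 0, a Bézout relation
    -- would make two consecutive integers map to 0.
    ∤⇒·1≉0 : ∀ {c} → ¬ p ℕ.∣ c → ¬ c · 1# ≈ 0#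
    ∤⇒·1≉0 {c} p∤c c≈0 with coprime-Bézout coprime
      where
      coprime : Coprime c p
      coprime (d∣c , d∣p) with prime⇒irreducible p-prime d∣p
      ... | inj₁ d≡1 = d≡1
      ... | inj₂ ≡.refl = contradiction d∣c p∤c
    ... | +- x y eq = consecutive (·1-multiple y p·1≈0) (·1-multiple x c≈0) eq
    ... | -+ x y eq = consecutive (·1-multiple x c≈0) (·1-multiple y p·1≈0) eq

  open Stepanov F inv inv-inverse public using (stepanov)

  1^n≈1 : ∀ n → 1# ^ n ≈ 1#
  1^n≈1 zero    = refl
  1^n≈1 (suc n) = trans (*-identityˡ _) (1^n≈1 n)

  -- The case j = 0 of `stepanov` with the single node 0, where the auxiliary polynomial is X^m - 1.
  rootsOfUnity-≤ : ∀ m bs → 1 ℕ.≤ m → Unique bs → All (λ b → b ^ m ≈ 1#) bs → length bs ℕ.≤ m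
  rootsOfUnity-≤ m bs 1≤m u roots = ≡.subst (ℕ._≤ m) (ℕ.*-identityˡ (length bs))
    (stepanov m 0 (0# ∷ []) bs ([] ∷ []) u ≡.refl 1≤m
      (All.map (λ {b} bᵐ≈1 → trans (^-congˡ m (+-identityˡ b)) bᵐ≈1 ∷ []) roots)
      λ C≈0 → nontrivial (trans (sym (trans (reflexive (≡.cong (_· 1#) [m+0]Cm≡1)) (×-homo-1 1#))) C≈0))
    where
    [m+0]Cm≡1 : (m ℕ.+ 0) C m ≡ 1
    [m+0]Cm≡1 = ≡.trans (≡.cong (_C m) (ℕ.+-identityʳ m)) (nCn≡1 m)

  -- Dividing by one member z₀ moves the whole fibre into the d-th roots of unity.
  powerFibre-≤ : ∀ d → 1 ℕ.≤ d → ∀ y zs → Unique zs → All (λ z → ¬ z ≈ 0#) zs → All (λ z → z ^ d ≈ y) zs → length zs ℕ.≤ d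
  powerFibre-≤ d 1≤d y []       _ _ _ = z≤n
  powerFibre-≤ d 1≤d y (z₀ ∷ zs) u (z₀≉0 ∷ _) fibre@(z₀ᵈ≈y ∷ _) =
    ≡.subst (ℕ._≤ d) (length-map (inv z₀ *_) (z₀ ∷ zs))
      (rootsOfUnity-≤ d (map (inv z₀ *_) (z₀ ∷ zs)) 1≤d (UniqueProperties.map⁺ setoid setoid (*-cancelˡ-≉0 inv-≉0) u) (All.map⁺ (All.map root fibre)))
    where
    inv-≉0 : ¬ inv z₀ ≈ 0#
    inv-≉0 i≈0 = nontrivial (trans (sym (inv-inverse z₀≉0)) (trans (*-congˡ i≈0) (zeroʳ z₀)))
    root : ∀ {z} → z ^ d ≈ y → (inv z₀ * z) ^ d ≈ 1#
    root {z} zᵈ≈y = begin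
      (inv z₀ * z) ^ d      ≈⟨ ^-distrib-* (inv z₀) z d ⟩
      inv z₀ ^ d * z ^ d    ≈⟨ *-congˡ (trans zᵈ≈y (sym z₀ᵈ≈y)) ⟩
      inv z₀ ^ d * z₀ ^ d   ≈⟨ ^-distrib-* (inv z₀) z₀ d ⟨
      (inv z₀ * z₀) ^ d     ≈⟨ ^-congˡ d (trans (*-comm (inv z₀) z₀) (inv-inverse z₀≉0)) ⟩
      1# ^ d                ≈⟨ 1^n≈1 d ⟩
      1#                    ∎

  -- Each unordered pair contributes once, which gives N(N+1)/2 entries in place of N².
  pairSums : List Carrier → List Carrier
  pairSums []       = []
  pairSums (a ∷ as) = map (a +_) (a ∷ as) ++ pairSums as

  2*length-pairSums : ∀ as → 2 ℕ.* length (pairSums as) ≡ length as ℕ.* suc (length as)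
  2*length-pairSums []       = ≡.refl
  2*length-pairSums (a ∷ as) = ≡.trans (≡.cong (2 ℕ.*_) (≡.trans (length-++ (map (a +_) (a ∷ as))) (≡.cong (ℕ._+ length (pairSums as)) (length-map (a +_) (a ∷ as)))))
    (≡.trans (ℕ.*-distribˡ-+ 2 (suc N) (length (pairSums as))) (≡.trans (≡.cong (2 ℕ.* suc N ℕ.+_) (2*length-pairSums as)) (rearrange N)))
    where
    N = length as
    rearrange : ∀ N → 2 ℕ.* suc N ℕ.+ N ℕ.* suc N ≡ suc N ℕ.* suc (suc N)
    rearrange = solve-∀

  ∈-pairSums : ∀ {a b as} → a ∈ as → b ∈ as → a + b ∈ pairSums as
  ∈-pairSums {as = a′ ∷ as} (here a≈) b∈ = MembershipProperties.∈-++⁺ˡ setoid (MembershipProperties.∈-resp-≈ setoid (+-congʳ (sym a≈)) (MembershipProperties.∈-map⁺ setoid setoid +-congˡ b∈))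
  ∈-pairSums {as = a′ ∷ as} (there a∈) (here b≈) = MembershipProperties.∈-++⁺ˡ setoid (MembershipProperties.∈-resp-≈ setoid (trans (+-congʳ (sym b≈)) (+-comm _ _)) (MembershipProperties.∈-map⁺ setoid setoid +-congˡ (there a∈)))
  ∈-pairSums {as = a′ ∷ as} (there a∈) (there b∈) = MembershipProperties.∈-++⁺ʳ setoid (map (a′ +_) (a′ ∷ as)) (∈-pairSums a∈ b∈)

open Arithmetic using (prime⇒∤1; prime∤2; not-good)
open import Data.Nat using (_+_; _*_; _∸_; _^_; _≤_; _<_)
open import Data.Nat.Divisibility using (_∣_)
open import Relation.Binary.PropositionalEquality using (refl; sym; trans; cong; subst)

-- The inequalities for a set A with A + A = S_d

module SumsetDecomposition
  (p n q d m : ℕ) (p-prime : Prime p) (q≡pⁿ : q ≡ p ^ n) (1≤d : 1 ≤ d) (1≤m : 1 ≤ m) (1+dm≡q : suc (d * m) ≡ q)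
  (F : CommutativeRing 0ℓ 0ℓ) (isFiniteField : IsFiniteField F q)
  (A : CommutativeRing.Carrier F → Bool) (A-subset : IsSubset F A) (A+A≡S : SumsetIsS F A d) where

  private module F = CommutativeRing F
  open F using (Carrier; _≈_; 0#; 1#)
  open IsFiniteField isFiniteField using (elements; complete; distinct)
  open FiniteField F q isFiniteField hiding (_≟_)
  open UniqueLists F.setoid using (length≤fibres)
  open UniqueSetoid F.setoid using (Unique)
  open MembershipSetoid F.setoid using (_∈_)
  open import Algebra.Properties.Ring F.ring using (+-cancelˡ; +-cancelʳ; x∙y⁻¹≈ε⇒x≈y)
  open import Algebra.Properties.Semiring.Exp F.semiring using (^-congˡ; ^-assocʳ) renaming (_^_ to _^ᶠ_)
  open import Algebra.Properties.Semiring.Mult F.semiring using () renaming (_×_ to _·_)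
  open import Relation.Binary.Reasoning.Setoid F.setoid

  length-units≡dm : length units ≡ d * m
  length-units≡dm = ℕ.suc-injective (trans length-units (sym 1+dm≡q))

  as : List Carrier
  as = filter (λ x → A x Data.Bool.≟ true) elements

  N : ℕ
  N = length as

  as-unique : Unique as
  as-unique = UniqueProperties.filter⁺ F.setoid (λ x → A x Data.Bool.≟ true) distinct

  as-⊆ : All (λ a → A a ≡ true) as
  as-⊆ = All.all-filter (λ x → A x Data.Bool.≟ true) elements

  ∈as : ∀ {a} → A a ≡ true → a ∈ as
  ∈as {a} = MembershipProperties.∈-filter⁺ F.setoid (λ x → A x Data.Bool.≟ true) (λ x≈y Ax → trans (sym (A-subset x≈y)) Ax) (complete a)

  sum-power : ∀ {a b} → A a ≡ true → A b ≡ true → (a F.+ b) ^ᶠ m ≈ 1#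
  sum-power {a} {b} Aa Ab with x , x≉0 , a+b≈xᵈ ← proj₁ (A+A≡S (a F.+ b)) (a , b , Aa , Ab , F.refl) = begin
    (a F.+ b) ^ᶠ m      ≈⟨ ^-congˡ m a+b≈xᵈ ⟩
    (x ^ᶠ d) ^ᶠ m       ≈⟨ ^-assocʳ x d m ⟩
    x ^ᶠ (d * m)        ≈⟨ F.reflexive (cong (x ^ᶠ_) length-units≡dm) ⟨
    x ^ᶠ length units   ≈⟨ fermat x≉0 ⟩
    1#                  ∎

  -- The d-th power map sends the dm units into the list of pair sums with fibres of size at most d,
  -- so dm ≤ d · N(N+1)/2; the exact size of S_d does not have to be computed.
  2m≤N[N+1] : 2 * m ≤ N * suc N
  2m≤N[N+1] = subst (2 * m ≤_) (2*length-pairSums as) (ℕ.*-monoʳ-≤ 2 (ℕ.*-cancelʳ-≤ m (length (pairSums as)) d {{ℕ.>-nonZero 1≤d}}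
    (subst (_≤ length (pairSums as) * d) (trans length-units≡dm (ℕ.*-comm d m))
      (length≤fibres {P = λ x → ¬ x ≈ 0#} (FiniteField._≟_ F q isFiniteField) (_^ᶠ d) d (powerFibre-≤ d 1≤d) units (pairSums as) units-unique units-≉0
        (All.map covered units-≉0)))))
    where
    covered : ∀ {x} → ¬ x ≈ 0# → x ^ᶠ d ∈ pairSums as
    covered {x} x≉0 with a , b , Aa , Ab , xᵈ≈ ← proj₂ (A+A≡S (x ^ᶠ d)) (x , x≉0 , F.refl) =
      MembershipProperties.∈-resp-≈ F.setoid (F.sym xᵈ≈) (∈-pairSums (∈as Aa) (∈as Ab))

  stepanov-bound : ∀ j → j < N → ¬ p ∣ (m + j) C m → suc j * N ≤ m
  stepanov-bound j j<N p∤C = stepanov m j (take (suc j) as) as (UniqueProperties.take⁺ F.setoid (suc j) as-unique) as-unique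
    (trans (length-take (suc j) as) (ℕ.m≤n⇒m⊓n≡m j<N)) 1≤m
    (All.map (λ Ab → All.map (λ Aa → sum-power Aa Ab) (All.take⁺ (suc j) as-⊆)) as-⊆)
    (∤⇒·1≉0 {n = n} p-prime q≡pⁿ p∤C)

  -- For a ≠ b in A the sums a+a, a+b, b+b are distinct m-th roots of unity; odd characteristic
  -- separates a+a from b+b.
  3≤m : p ≢ 2 → 2 ≤ N → 3 ≤ m
  3≤m p≢2 2≤N = two as as-unique as-⊆ 2≤N
    where
    double-injective : ∀ {a b} → a F.+ a ≈ b F.+ b → a ≈ b
    double-injective {a} {b} 2a≈2b = *-cancelˡ-≉0 (∤⇒·1≉0 {n = n} p-prime q≡pⁿ (prime∤2 p-prime p≢2)) (begin
      (2 · 1#) F.* a  ≈⟨ double a ⟩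
      a F.+ a         ≈⟨ 2a≈2b ⟩
      b F.+ b         ≈⟨ double b ⟨
      (2 · 1#) F.* b  ∎)
      where
      double : ∀ x → (2 · 1#) F.* x ≈ x F.+ x
      double x = F.trans (F.distribʳ x 1# (1# F.+ 0#)) (F.+-cong (F.*-identityˡ x) (F.trans (F.*-congʳ (F.+-identityʳ 1#)) (F.*-identityˡ x)))
    two : ∀ xs → Unique xs → All (λ a → A a ≡ true) xs → 2 ≤ length xs → 3 ≤ m
    two (_ ∷ []) _ _ (s≤s ())
    two (a ∷ b ∷ _) ((a≉b ∷ _) ∷ _) (Aa ∷ Ab ∷ _) _ = rootsOfUnity-≤ m (a F.+ a ∷ a F.+ b ∷ b F.+ b ∷ []) 1≤m
      ( ((λ eq → a≉b (+-cancelˡ a a b eq)) ∷ (λ eq → a≉b (double-injective eq)) ∷ [])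
      ∷ ((λ eq → a≉b (+-cancelʳ b a b eq)) ∷ [])
      ∷ [] ∷ [])
      (sum-power Aa Aa ∷ sum-power Aa Ab ∷ sum-power Ab Ab ∷ [])

theorem1p3 : (p n q d : ℕ) → Prime p → q ≡ p ^ n
    → d ∣ q ∸ 1 → 2 ≤ d → d < q ∸ 1
    → (m : ℕ) → q ∸ 1 ≡ d * m
    → Good p n d m
    → (F : CommutativeRing 0ℓ 0ℓ) → IsFiniteField F q
    → (A : CommutativeRing.Carrier F → Bool) → IsSubset F A
    → ¬ SumsetIsS F A d
theorem1p3 zero    _ _ _ p-prime = contradiction p-prime ¬prime[0]
theorem1p3 p@(suc k) n q d p-prime q≡pⁿ _ 2≤d d<q-1 m q-1≡dm good F isFiniteField A A-subset A+A≡S =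
  not-good k p-prime m N stepanov-bound 2m≤N[N+1] 2≤m n d p∤m 2≤d 1+dm≡pⁿ 3≤m good
  where
  1+dm≡pⁿ : suc (d * m) ≡ p ^ n
  1+dm≡pⁿ = trans (cong suc (sym q-1≡dm)) (trans (ℕ.m+[n∸m]≡n {1} {q} (subst (1 ≤_) (sym q≡pⁿ) (ℕ.m^n>0 p n))) q≡pⁿ)
  d*1<dm : d * 1 < d * m
  d*1<dm = subst (_< d * m) (sym (ℕ.*-identityʳ d)) (subst (d <_) q-1≡dm d<q-1)
  2≤m : 2 ≤ m
  2≤m = ℕ.*-cancelˡ-< d 1 m d*1<dm
  -- A factor p of m would divide p^n - dm = 1. The exponent n = 0 is separate: it would make dm =
  -- 0, against d < dm.
  p∤m : ¬ p ∣ m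
  p∤m p∣m = not-one n 1+dm≡pⁿ
    where
    not-one : ∀ n → suc (d * m) ≢ p ^ n
    not-one zero    eq = contradiction (subst (d * 1 <_) (ℕ.suc-injective eq) d*1<dm) (λ ())
    not-one (suc n) eq = prime⇒∤1 p-prime (ℕ.∣m+n∣m⇒∣n (subst (p ∣_) (trans (sym eq) (ℕ.+-comm 1 (d * m))) (ℕ.m∣m*n (p ^ n))) (ℕ.∣n⇒∣m*n d p∣m))
  open SumsetDecomposition p n q d m p-prime q≡pⁿ (ℕ.≤-trans (s≤s z≤n) 2≤d) (ℕ.≤-trans (s≤s z≤n) 2≤m) (trans 1+dm≡pⁿ (sym q≡pⁿ)) F isFiniteField A A-subset A+A≡S
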